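{- There is an algorithm that, given a finite bipartite graph $G$ with $s$ vertices, decides whether $G$ is 2-chordal bipartite in time bounded by a polynomial in $s$.
   Context: Graphs are finite and simple. A bipartite graph $G=(X,Y,E)$ has disjoint vertex classes $X,Y$ with every edge joining $X$ to $Y$. A chord of a cycle $C$ is an edge of the graph joining two vertices of $C$ that is not an edge of $C$. A bipartite graph is 2-chordal bipartite if every cycle of length at least $6$ has at least two chords. -}

module Defs where

open import Data.Nat using (ℕ; zero; suc; _+_; _*_; _^_; _≤_; _<_)
open import Data.Fin using (Fin; toℕ; inject₁; fromℕ) renaming (zero to fzero; suc to fsuc)
open import Data.Bool using (Bool; true; false; not)
open import Data.List using (List; []; _∷_; _++_; map; concatMap; allFin)
open import Data.Maybe using (Maybe; just; nothing)
open import Data.Sum using (_⊎_; inj₁; inj₂)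
open import Data.Product using (_×_; _,_; ∃-syntax)
open import Relation.Binary.PropositionalEquality using (_≡_; _≢_)
open import Relation.Nullary using (¬_)
open import Function.Definitions using (Injective)

-- Finite simple bipartite graphs on vertex set Fin s.
-- side v = true means v ∈ X, side v = false means v ∈ Y.

record BipartiteGraph (s : ℕ) : Set where
  field
    adj    : Fin s → Fin s → Bool
    side   : Fin s → Bool
    sym    : ∀ u v → adj u v ≡ adj v u
    irrefl : ∀ u → adj u u ≡ false
    bip    : ∀ u v → adj u v ≡ true → side u ≡ not (side v)
open BipartiteGraph public

module _ {s : ℕ} (G : BipartiteGraph s) where

  record IsCycle (n : ℕ) (c : Fin (suc n) → Fin s) : Set where
    field
      distinct : Injective _≡_ _≡_ c
      step     : ∀ (i : Fin n) → adj G (c (inject₁ i)) (c (fsuc i)) ≡ true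
      closing  : adj G (c (fromℕ n)) (c fzero) ≡ true

  Chord : (n : ℕ) → (Fin (suc n) → Fin s) → Fin (suc n) → Fin (suc n) → Set
  Chord n c i j =
    toℕ i < toℕ j × adj G (c i) (c j) ≡ true
    × toℕ j ≢ suc (toℕ i) × ¬ (toℕ i ≡ 0 × toℕ j ≡ n)

  TwoChordalBipartite : Set
  TwoChordalBipartite =
    ∀ (n : ℕ) (c : Fin (suc n) → Fin s) → 6 ≤ suc n → IsCycle n c →
    ∃[ i ] ∃[ j ] ∃[ i' ] ∃[ j' ]
      (Chord n c i j × Chord n c i' j' × (i ≢ i' ⊎ j ≢ j'))

data Move : Set where
  left right stay : Move

Sym : ℕ → Set
Sym g = Fin (3 + g)

blank : ∀ {g} → Sym g
blank = fzero

bit : ∀ {g} → Bool → Sym g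
bit false = fsuc fzero
bit true  = fsuc (fsuc fzero)

record TM : Set where
  field
    states : ℕ
    extra  : ℕ
    start  : Fin states
    -- inj₁ b : halt with answer b;  inj₂ (q , a , m) : write a, move m, go to q
    δ      : Fin states → Sym extra → Bool ⊎ (Fin states × Sym extra × Move)

module _ (M : TM) where
  open TM M

  -- left part stored reversed (nearest cell first); unlisted cells are blank
  record Config : Set where
    constructor cfg
    field
      state : Fin states
      lft   : List (Sym extra)
      head  : Sym extra
      rgt   : List (Sym extra)

  moveHead : Move → List (Sym extra) → Sym extra → List (Sym extra)
           → List (Sym extra) × Sym extra × List (Sym extra)
  moveHead stay  l a r = l , a , r
  moveHead left  []      a r = [] , blank , a ∷ r
  moveHead left  (x ∷ l) a r = l , x , a ∷ r
  moveHead right l a []      = a ∷ l , blank , []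
  moveHead right l a (x ∷ r) = a ∷ l , x , r

  stepTM : Config → Bool ⊎ Config
  stepTM (cfg q l a r) with δ q a
  ... | inj₁ b = inj₁ b
  ... | inj₂ (q' , a' , m) with moveHead m l a' r
  ...   | (l' , h' , r') = inj₂ (cfg q' l' h' r')

  run : ℕ → Config → Maybe Bool
  run zero    _ = nothing
  run (suc t) c with stepTM c
  ... | inj₁ b  = just b
  ... | inj₂ c' = run t c'

  initial : List (Sym extra) → Config
  initial []      = cfg start [] blank []
  initial (x ∷ w) = cfg start [] x w

  HaltsWithin : List (Sym extra) → ℕ → Bool → Set
  HaltsWithin w t b = run t (initial w) ≡ just b

encode : ∀ {g s} → BipartiteGraph s → List (Sym g)
encode {s = s} G =
  concatMap (λ u → map (λ v → bit (adj G u v)) (allFin s)) (allFin s)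
  ++ map (λ u → bit (side G u)) (allFin s)

{-# OPTIONS --safe #-}
module Submission where

-- A cycle of length at least 6 with at most one chord exists iff there are edges ab, bc, cd with a, d
-- not adjacent such that d can be reached from a without entering a neighbour of b.  Given such a
-- cycle, let c be an end of its chord and b, a the next two vertices; then the rest of the cycle leads
-- from a to the predecessor d of c.  Conversely, a shortest path from a to the first vertex d adjacent
-- to c but not to a closes up through c and b to a cycle of length at least 6, whose only possible
-- chord joins c to the second vertex of the path.
--
-- This criterion is tested on a Turing machine whose tape carries 20 parallel Boolean tracks, the first
-- of which holds the input of length N = s (s + 1).  The program is built from single sweeps of the head (assign a
-- track, shift a track by one position, test whether some position satisfies a condition) and loops of
-- N rounds, so its running time is a polynomial in N by induction on the program.  The k-th vertex is
-- held in two tracks, one marking the k-th row of the adjacency matrix and one the k-th column;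
-- adjacency of two vertices is then a single test sweep.

open import Defs hiding (sym)
open import Data.Nat using (ℕ; zero; suc; pred; _+_; _*_; _^_; _≤_; _<_; z≤n; s≤s; s≤s⁻¹; _≡ᵇ_; _<ᵇ_; _⊓_; _<?_; _≤?_)
open import Data.Nat.Properties hiding (_≟_)
open import Data.Nat.DivMod using (_/_; _%_; m≡m%n+[m/n]*n; m%n<n; [m+kn]%n≡m%n; m<n⇒m%n≡m)
open import Data.Nat.Induction using (<-rec)
open import Data.Nat.Tactic.RingSolver using (solve-∀)
open import Data.Bool using (Bool; true; false; if_then_else_; not; _∧_; _∨_)
import Data.Bool.Properties as Bool
open import Data.Bool.Properties using (∨-zeroʳ; T-≡)
open import Data.Maybe using (Maybe; just; nothing)
open import Data.List as List using (List; []; _∷_; _++_; map; concatMap; allFin; replicate; length; reverse; _ʳ++_)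
open import Data.List.Properties using (++-identityʳ; ++-assoc; ʳ++-defn; reverse-involutive; length-reverse; reverse-map; map-concatMap; map-++; map-∘; concatMap-cong; map-tabulate; length-tabulate; length-map; length-++)
open import Data.Fin as Fin using (Fin; toℕ; fromℕ; fromℕ<; inject₁; #_) renaming (zero to fzero; suc to fsuc)
open import Data.Fin.Properties using (_≟_; any?; splitAt-join; remQuot-combine; toℕ-injective; toℕ-fromℕ; toℕ-fromℕ<; toℕ-inject₁; toℕ<n; toℕ≤pred[n]; injective⇒≤)
open import Data.Vec using (Vec; []; _∷_; lookup; tabulate)
open import Data.Vec.Properties using (lookup∘tabulate; tabulate-cong)
open import Data.Sum as Sum using (_⊎_; inj₁; inj₂)
open import Data.Product using (Σ; ∃-syntax; _×_; _,_; proj₁; proj₂)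
open import Data.Empty using (⊥; ⊥-elim)
open import Function using (_∘_)
open import Function.Bundles using (_⇔_; mk⇔; Equivalence)
open import Relation.Nullary using (¬_; Dec; yes; no; does; contradiction; ¬?)
open import Relation.Nullary.Decidable using (_×-dec_; _⊎-dec_; decidable-stable)
open import Relation.Binary.PropositionalEquality hiding (inspect)

-- The walk from a to d avoids neighbours of b so that the closing cycle has no chord at b.
-- Non-adjacency of a and d, together with bipartiteness, forces the walk to have length at least 3
-- and the cycle length at least 6. The chord from c to the second path vertex cannot be excluded:
-- that vertex is adjacent to a, hence not eligible as d. It is the single chord that the property
-- does not tolerate alone. The two directions treat walk lengths differently. An obstruction of any
-- length refutes the property, but only lengths up to N need be searched: the walk round a cycle is
-- charged at most 2s steps, and 2s is at most s (s + 1) once s is positive. The machine is given N,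
-- not s. It recovers s in unary; numbers occur on the tape only as initial segments of marked cells
-- or as positions of a mark, and multiplication is iterated shifting. Most side conditions say that
-- a piece of program leaves a track alone. They are Boolean functions of the syntax, so on concrete
-- programs they hold by computation.

record Finite (A : Set) : Set where
  field
    size    : ℕ
    to      : A → Fin size
    from    : Fin size → A
    from∘to : ∀ x → from (to x) ≡ x

Bool-finite : Finite Bool
Bool-finite = record
  { size = 2
  ; to = λ { false → fzero ; true → fsuc fzero }
  ; from = λ { fzero → false ; (fsuc _) → true }
  ; from∘to = λ { false → refl ; true → refl } }

⊎-finite : ∀ {A B} → Finite A → Finite B → Finite (A ⊎ B)
⊎-finite FA FB = record
  { size = A.size + B.size
  ; to = Fin.join A.size B.size ∘ Sum.map A.to B.to
  ; from = Sum.map A.from B.from ∘ Fin.splitAt A.size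
  ; from∘to = inverse }
  where
  module A = Finite FA
  module B = Finite FB
  inverse : ∀ x → Sum.map A.from B.from (Fin.splitAt A.size (Fin.join A.size B.size (Sum.map A.to B.to x))) ≡ x
  inverse x rewrite splitAt-join A.size B.size (Sum.map A.to B.to x) with x
  ... | inj₁ a = cong inj₁ (A.from∘to a)
  ... | inj₂ b = cong inj₂ (B.from∘to b)

Vec-finite : ∀ {A} → Finite A → ∀ k → Finite (Vec A k)
Vec-finite F zero = record
  { size = 1 ; to = λ _ → fzero ; from = λ _ → [] ; from∘to = λ { [] → refl } }
Vec-finite {A} F (suc k) = record
  { size = F.size * Fs.size ; to = to ; from = from ; from∘to = inverse }
  where
  module F = Finite F
  module Fs = Finite (Vec-finite F k)
  to : Vec A (suc k) → Fin (F.size * Fs.size)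
  to (x ∷ xs) = Fin.combine (F.to x) (Fs.to xs)
  pair : Fin F.size × Fin Fs.size → Vec A (suc k)
  pair (i , j) = F.from i ∷ Fs.from j
  from : Fin (F.size * Fs.size) → Vec A (suc k)
  from = pair ∘ Fin.remQuot Fs.size
  inverse : ∀ x → from (to x) ≡ x
  inverse (x ∷ xs) = trans (cong pair (remQuot-combine (F.to x) (Fs.to xs)))
                           (cong₂ _∷_ (F.from∘to x) (Fs.from∘to xs))

-- Tape machines over an arbitrary alphabet, composed from sweeps.

module Machine (Cell : Set) where

  Square : Set
  Square = Maybe Cell

  record Tape : Set where
    constructor tape
    field
      before : List Square
      here   : Square
      after  : List Square

  load : List Square → List Square → Tape
  load l []      = tape l nothing []
  load l (x ∷ r) = tape l x r

  moveTape : Move → List Square → Square → List Square → Tape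
  moveTape stay  l       a r = tape l a r
  moveTape right l       a r = load (a ∷ l) r
  moveTape left  []      a r = tape [] nothing (a ∷ r)
  moveTape left  (x ∷ l) a r = tape l x (a ∷ r)

  Action : Set → Set
  Action Q = Bool ⊎ (Q × Square × Move)

  Control : Set → Set
  Control Q = Q → Square → Action Q

  -- Halting costs one step, as in `run`. The final tape is recorded so that another machine can
  -- continue on it.
  data Run {Q : Set} (δ : Control Q) : ℕ → Q → Tape → Bool → Tape → Set where
    halt : ∀ {q l h r b} → δ q h ≡ inj₁ b → Run δ 1 q (tape l h r) b (tape l h r)
    step : ∀ {q l h r b q′ h′ m t T} → δ q h ≡ inj₂ (q′ , h′ , m) →
           Run δ t q′ (moveTape m l h′ r) b T → Run δ (suc t) q (tape l h r) b T

  relay : ∀ {P Q : Set} → (P → Q) → (Bool → Q) → Square → Action P → Action Q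
  relay ι κ h (inj₁ b)            = inj₂ (κ b , h , stay)
  relay ι κ h (inj₂ (p , h′ , m)) = inj₂ (ι p , h′ , m)

  rename : ∀ {P Q : Set} → (P → Q) → Action P → Action Q
  rename ι (inj₁ b)            = inj₁ b
  rename ι (inj₂ (p , h′ , m)) = inj₂ (ι p , h′ , m)

  -- The halting step of the first machine becomes the hand-over step of the composite, so the times
  -- add exactly.
  Run-relay : ∀ {P Q : Set} {δ₁ : Control P} {δ : Control Q} (ι : P → Q) (κ : Bool → Q) →
    (∀ p h → δ (ι p) h ≡ relay ι κ h (δ₁ p h)) →
    ∀ {t t′ p T b T′ b′ T″} → Run δ₁ t p T b T′ → Run δ t′ (κ b) T′ b′ T″ →
    Run δ (t + t′) (ι p) T b′ T″
  Run-relay ι κ sim {p = p} (halt {h = h} e) next =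
    step (trans (sim p h) (cong (relay ι κ h) e)) next
  Run-relay ι κ sim {p = p} (step {h = h} e rest) next =
    step (trans (sim p h) (cong (relay ι κ h) e)) (Run-relay ι κ sim rest next)

  Run-rename : ∀ {P Q : Set} {δ₁ : Control P} {δ : Control Q} (ι : P → Q) →
    (∀ p h → δ (ι p) h ≡ rename ι (δ₁ p h)) →
    ∀ {t p T b T′} → Run δ₁ t p T b T′ → Run δ t (ι p) T b T′
  Run-rename ι sim {p = p} (halt {h = h} e) = halt (trans (sim p h) (cong (rename ι) e))
  Run-rename ι sim {p = p} (step {h = h} e rest) =
    step (trans (sim p h) (cong (rename ι) e)) (Run-rename ι sim rest)

  again : ∀ {Q : Set} → Q → Square → Action Q → Action Q
  again q h (inj₁ true)  = inj₂ (q , h , stay)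
  again q h (inj₁ false) = inj₁ false
  again q h (inj₂ a)     = inj₂ a

  Run-again : ∀ {Q : Set} {δ₁ δ : Control Q} (q₀ : Q) → (∀ q h → δ q h ≡ again q₀ h (δ₁ q h)) →
    ∀ {t t′ q T T′ b T″} → Run δ₁ t q T true T′ → Run δ t′ q₀ T′ b T″ → Run δ (t + t′) q T b T″
  Run-again q₀ sim {q = q} (halt {h = h} e) next =
    step (trans (sim q h) (cong (again q₀ h) e)) next
  Run-again q₀ sim {q = q} (step {h = h} e rest) next =
    step (trans (sim q h) (cong (again q₀ h) e)) (Run-again q₀ sim rest next)

  Run-exit : ∀ {Q : Set} {δ₁ δ : Control Q} (q₀ : Q) → (∀ q h → δ q h ≡ again q₀ h (δ₁ q h)) →
    ∀ {t q T T′} → Run δ₁ t q T false T′ → Run δ t q T false T′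
  Run-exit q₀ sim {q = q} (halt {h = h} e) = halt (trans (sim q h) (cong (again q₀ h) e))
  Run-exit q₀ sim {q = q} (step {h = h} e rest) =
    step (trans (sim q h) (cong (again q₀ h) e)) (Run-exit q₀ sim rest)

  -- One carried bit suffices for all sweeps: for a shift it is the previous cell's value, for a
  -- search it tells whether a hit has occurred.
  Mealy : Set
  Mealy = Bool → Cell → Bool × Cell

  mealy : Mealy → Bool → List Cell → Bool × List Cell
  mealy m b []       = b , []
  mealy m b (c ∷ cs) = let b′ , c′ = m b c ; b″ , cs′ = mealy m b′ cs in b″ , c′ ∷ cs′

  data Code : Set where
    sweep  : Mealy → Bool → Code
    seq    : Code → Code → Code
    branch : Code → Code → Code → Code
    repeat : Code → Code

  Point : Code → Set
  Point (sweep _ _)    = Bool ⊎ Bool ⊎ Bool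
  Point (seq p q)      = Point p ⊎ Point q
  Point (branch c p q) = Point c ⊎ Point p ⊎ Point q
  Point (repeat p)     = Point p

  Point-finite : ∀ p → Finite (Point p)
  Point-finite (sweep _ _)    = ⊎-finite Bool-finite (⊎-finite Bool-finite Bool-finite)
  Point-finite (seq p q)      = ⊎-finite (Point-finite p) (Point-finite q)
  Point-finite (branch c p q) = ⊎-finite (Point-finite c) (⊎-finite (Point-finite p) (Point-finite q))
  Point-finite (repeat p)     = Point-finite p

  entry : ∀ p → Point p
  entry (sweep _ b)    = inj₁ b
  entry (seq p _)      = inj₁ (entry p)
  entry (branch c _ _) = inj₁ (entry c)
  entry (repeat p)     = entry p

  pattern forward b  = inj₁ b
  pattern backward b = inj₂ (inj₁ b)
  pattern done b     = inj₂ (inj₂ b)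

  δ : ∀ p → Control (Point p)
  δ (sweep m _) (forward b)  (just c) = let b′ , c′ = m b c in inj₂ (forward b′ , just c′ , right)
  δ (sweep m _) (forward b)  nothing  = inj₂ (backward b , nothing , left)
  δ (sweep m _) (backward b) (just c) = inj₂ (backward b , just c , left)
  δ (sweep m _) (backward b) nothing  = inj₂ (done b , nothing , right)
  δ (sweep m _) (done b)     _        = inj₁ b
  δ (seq p q) (inj₁ x) h = relay inj₁ (λ _ → inj₂ (entry q)) h (δ p x h)
  δ (seq p q) (inj₂ y) h = rename inj₂ (δ q y h)
  δ (branch c p q) (inj₁ x)        h =
    relay inj₁ (λ b → if b then inj₂ (inj₁ (entry p)) else inj₂ (inj₂ (entry q))) h (δ c x h)
  δ (branch c p q) (inj₂ (inj₁ x)) h = rename (inj₂ ∘ inj₁) (δ p x h)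
  δ (branch c p q) (inj₂ (inj₂ x)) h = rename (inj₂ ∘ inj₂) (δ q x h)
  δ (repeat p) x h = again (entry p) h (δ p x h)

  blanks : ℕ → List Square
  blanks i = replicate i nothing

  -- Blanks once visited stay listed, so sweeps restore the tape only up to padding on both sides;
  -- the two numbers absorb it.
  Home : List Cell → Tape → Set
  Home w T = ∃[ i ] ∃[ j ] T ≡ load (blanks i) (map just w ++ blanks j)

  record Exec (p : Code) (B : ℕ) (w : List Cell) (b : Bool) (w′ : List Cell) : Set where
    constructor exec
    field
      from-home : ∀ T → Home w T → ∃[ t ] ∃[ T′ ] (t ≤ B × Home w′ T′ × Run (δ p) t (entry p) T b T′)

  Exec-weaken : ∀ {p B B′ w b w′} → B ≤ B′ → Exec p B w b w′ → Exec p B′ w b w′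
  Exec-weaken B≤ (exec e) .Exec.from-home T home with e T home
  ... | t , T′ , t≤ , home′ , r = t , T′ , ≤-trans t≤ B≤ , home′ , r

  Exec-seq : ∀ {p q B B′ w b w′ b′ w″} → Exec p B w b w′ → Exec q B′ w′ b′ w″ →
             Exec (seq p q) (B + B′) w b′ w″
  Exec-seq (exec e) (exec e′) .Exec.from-home T home with e T home
  ... | t , T′ , t≤ , home′ , r with e′ T′ home′
  ... | t′ , T″ , t′≤ , home″ , r′ =
    t + t′ , T″ , +-mono-≤ t≤ t′≤ , home″ ,
    Run-relay inj₁ _ (λ _ _ → refl) r (Run-rename inj₂ (λ _ _ → refl) r′)

  Exec-branch-true : ∀ {c p q B B′ w w′ b w″} → Exec c B w true w′ → Exec p B′ w′ b w″ →
                     Exec (branch c p q) (B + B′) w b w″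
  Exec-branch-true (exec e) (exec e′) .Exec.from-home T home with e T home
  ... | t , T′ , t≤ , home′ , r with e′ T′ home′
  ... | t′ , T″ , t′≤ , home″ , r′ =
    t + t′ , T″ , +-mono-≤ t≤ t′≤ , home″ ,
    Run-relay inj₁ _ (λ _ _ → refl) r (Run-rename (inj₂ ∘ inj₁) (λ _ _ → refl) r′)

  Exec-branch-false : ∀ {c p q B B′ w w′ b w″} → Exec c B w false w′ → Exec q B′ w′ b w″ →
                      Exec (branch c p q) (B + B′) w b w″
  Exec-branch-false (exec e) (exec e′) .Exec.from-home T home with e T home
  ... | t , T′ , t≤ , home′ , r with e′ T′ home′
  ... | t′ , T″ , t′≤ , home″ , r′ =
    t + t′ , T″ , +-mono-≤ t≤ t′≤ , home″ ,
    Run-relay inj₁ _ (λ _ _ → refl) r (Run-rename (inj₂ ∘ inj₂) (λ _ _ → refl) r′)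

  Exec-repeat : ∀ {p B B′ w w′ b w″} → Exec p B w true w′ → Exec (repeat p) B′ w′ b w″ →
                Exec (repeat p) (B + B′) w b w″
  Exec-repeat {p} (exec e) (exec e′) .Exec.from-home T home with e T home
  ... | t , T′ , t≤ , home′ , r with e′ T′ home′
  ... | t′ , T″ , t′≤ , home″ , r′ = t + t′ , T″ , +-mono-≤ t≤ t′≤ , home″ ,
    Run-again (entry p) (λ _ _ → refl) r r′

  Exec-exit : ∀ {p B w w′} → Exec p B w false w′ → Exec (repeat p) B w false w′
  Exec-exit {p} (exec e) .Exec.from-home T home with e T home
  ... | t , T′ , t≤ , home′ , r = t , T′ , t≤ , home′ , Run-exit (entry p) (λ _ _ → refl) r

  module _ (m : Mealy) (b₀ : Bool) where

    Run-forward : ∀ cs {b t l j b′ T} →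
      Run (δ (sweep m b₀)) t (forward (proj₁ (mealy m b cs)))
        (load (map just (proj₂ (mealy m b cs)) ʳ++ l) (blanks j)) b′ T →
      Run (δ (sweep m b₀)) (length cs + t) (forward b) (load l (map just cs ++ blanks j)) b′ T
    Run-forward []       r = r
    Run-forward (c ∷ cs) r = step refl (Run-forward cs r)

    Run-backward : ∀ cs {b} i a r → ∃[ i′ ]
      Run (δ (sweep m b₀)) (length cs + 2) (backward b) (moveTape left (map just cs ++ blanks i) a r) b
        (load (blanks i′) (map just cs ʳ++ (a ∷ r)))
    -- Here the head leaves the listed part, which adds one blank on the left.
    Run-backward [] zero    a r = 1 , step refl (halt refl)
    Run-backward [] (suc i) a r = suc i , step refl (halt refl)
    Run-backward (c ∷ cs) i a r with Run-backward cs i (just c) (a ∷ r)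
    ... | i′ , run = i′ , step refl run

    -- The blank at the right end may be listed or implicit; `pred` makes both cases leave the same
    -- right part.
    Run-turn : ∀ {b l t b′ T} j →
      Run (δ (sweep m b₀)) t (backward b) (moveTape left l nothing (blanks (pred j))) b′ T →
      Run (δ (sweep m b₀)) (suc t) (forward b) (load l (blanks j)) b′ T
    Run-turn zero    r = step refl r
    Run-turn (suc j) r = step refl r

    length-mealy : ∀ b cs → length (proj₂ (mealy m b cs)) ≡ length cs
    length-mealy b []       = refl
    length-mealy b (c ∷ cs) = cong suc (length-mealy _ cs)

    Exec-sweep : ∀ w → Exec (sweep m b₀) (3 + 2 * length w) w (proj₁ (mealy m b₀ w)) (proj₂ (mealy m b₀ w))
    Exec-sweep w .Exec.from-home T (i , j , refl) =
      _ , home , ≤-reflexive time , (i′ , suc j′ , final) ,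
      Run-forward w (Run-turn j (subst (λ l → Run (δ (sweep m b₀)) _ _ (moveTape left l nothing (blanks j′)) _ home)
                                   (sym prefix) (proj₂ back)))
      where
      w′ : List Cell
      w′ = proj₂ (mealy m b₀ w)
      prefix : map just w′ ʳ++ blanks i ≡ map just (reverse w′) ++ blanks i
      prefix = trans (ʳ++-defn (map just w′)) (cong (_++ blanks i) (sym (reverse-map just w′)))
      j′ : ℕ
      j′ = pred j
      back = Run-backward (reverse w′) i nothing (blanks j′)
      i′ : ℕ
      i′ = proj₁ back
      home : Tape
      home = load (blanks i′) (map just (reverse w′) ʳ++ blanks (suc j′))
      final : home ≡ load (blanks i′) (map just w′ ++ blanks (suc j′))
      final = cong (load (blanks i′)) (trans (ʳ++-defn (map just (reverse w′)))
        (cong (_++ blanks (suc j′)) (trans (sym (reverse-map just (reverse w′))) (cong (map just) (reverse-involutive w′)))))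
      time : length w + suc (length (reverse w′) + 2) ≡ 3 + 2 * length w
      time rewrite length-reverse w′ | length-mealy b₀ w | +-suc (length w) (length w + 2)
        | +-comm (length w) 2 | +-identityʳ (length w) | +-suc (length w) (suc (length w)) | +-suc (length w) (length w) = refl

  -- From tape machines to Turing machines.

  module Realize (FC : Finite Cell) (input : Bool → Cell) (p : Code) where
    private
      module FC = Finite FC
      module FQ = Finite (Point-finite p)

    -- Input bits are read as cells, so the machine needs no pass that initialises the tape.
    decode : Sym FC.size → Square
    decode fzero                            = nothing
    decode (fsuc fzero)                  = just (input false)
    decode (fsuc (fsuc fzero))        = just (input true)
    decode (fsuc (fsuc (fsuc c)))     = just (FC.from c)

    code : Square → Sym FC.size
    code nothing  = blank
    code (just c) = fsuc (fsuc (fsuc (FC.to c)))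

    decode-code : ∀ h → decode (code h) ≡ h
    decode-code nothing  = refl
    decode-code (just c) = cong just (FC.from∘to c)

    decode-bit : ∀ b → decode (bit b) ≡ just (input b)
    decode-bit false = refl
    decode-bit true  = refl

    codeAction : Action (Point p) → Bool ⊎ (Fin FQ.size × Sym FC.size × Move)
    codeAction (inj₁ b)           = inj₁ b
    codeAction (inj₂ (q , h , m)) = inj₂ (FQ.to q , code h , m)

    machine : TM
    machine = record
      { states = FQ.size ; extra = FC.size ; start = FQ.to (entry p)
      ; δ = λ q a → codeAction (δ p (FQ.from q) (decode a)) }

    decodeTape : List (Sym FC.size) → Sym FC.size → List (Sym FC.size) → Tape
    decodeTape l h r = tape (map decode l) (decode h) (map decode r)

    decode-move : ∀ mv l h r → let l′ , h′ , r′ = moveHead machine mv l (code h) r in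
      decodeTape l′ h′ r′ ≡ moveTape mv (map decode l) h (map decode r)
    decode-move stay  l       h r       = cong (λ x → tape _ x _) (decode-code h)
    decode-move left  []      h r       = cong (λ x → tape _ _ (x ∷ _)) (decode-code h)
    decode-move left  (x ∷ l) h r       = cong (λ x → tape _ _ (x ∷ _)) (decode-code h)
    decode-move right l       h []      = cong (λ x → tape (x ∷ _) _ _) (decode-code h)
    decode-move right l       h (x ∷ r) = cong (λ x → tape (x ∷ _) _ _) (decode-code h)

    -- An input bit and the cell it stands for are different symbols with the same decoding, so the
    -- simulation compares decoded tapes.
    runs : ∀ {t q T b T′} l h r → Run (δ p) t q T b T′ → T ≡ decodeTape l h r →
           run machine t (cfg (FQ.to q) l h r) ≡ just b
    runs {q = q} l h r (halt e) refl rewrite FQ.from∘to q | e = refl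
    runs {q = q} l h r (step {q′ = q′} {h′} {m} e rest) refl
      rewrite FQ.from∘to q | e = runs _ _ _ rest (sym (decode-move m l h′ r))

    run-mono : ∀ {t t′ c b} → t ≤ t′ → run machine t c ≡ just b → run machine t′ c ≡ just b
    run-mono {suc t} {suc t′} {c} (s≤s t≤) e with stepTM machine c
    ... | inj₁ _  = e
    ... | inj₂ c′ = run-mono t≤ e

    Exec-halts : ∀ {B b w′} (bs : List Bool) → Exec p B (map input bs) b w′ →
                 HaltsWithin machine (map bit bs) B b
    Exec-halts {B} {b} bs (exec e) with e (load [] (map just (map input bs))) (0 , 0 , cong (load []) (sym (++-identityʳ′ _)))
      where
      ++-identityʳ′ : ∀ {A : Set} (xs : List A) → xs ++ [] ≡ xs
      ++-identityʳ′ = ++-identityʳ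
    ... | t , T′ , t≤ , _ , r = run-mono t≤ (start bs r)
      where
      cells : ∀ bs → map just (map input bs) ≡ map decode (map bit bs)
      cells []       = refl
      cells (b ∷ bs) = cong₂ _∷_ (sym (decode-bit b)) (cells bs)
      start : ∀ bs → Run (δ p) t (entry p) (load [] (map just (map input bs))) b T′ →
              run machine t (initial machine (map bit bs)) ≡ just b
      start []       r = runs [] blank [] r refl
      start (x ∷ xs) r = runs [] (bit x) (map bit xs) r (cong (load []) (cells (x ∷ xs)))

-- Bounded search and polynomial bounds.

∧-split : ∀ {x y} → x ∧ y ≡ true → x ≡ true × y ≡ true
∧-split {true} {true} _ = refl , refl

exceeds : ∀ {m n} → m < n → (m <ᵇ n) ≡ true
exceeds lt = Equivalence.to T-≡ (<⇒<ᵇ lt)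

<ᵇ-true⇒< : ∀ m n → (m <ᵇ n) ≡ true → m < n
<ᵇ-true⇒< m n e = <ᵇ⇒< m n (Equivalence.from T-≡ e)

≡ᵇ-true⇒≡ : ∀ m n → (m ≡ᵇ n) ≡ true → m ≡ n
≡ᵇ-true⇒≡ m n e = ≡ᵇ⇒≡ m n (Equivalence.from T-≡ e)

≡ᵇ-refl : ∀ n → (n ≡ᵇ n) ≡ true
≡ᵇ-refl n = Equivalence.to T-≡ (≡⇒≡ᵇ n n refl)

≢true⇒false : ∀ {b} → (b ≡ true → b ≡ false) → b ≡ false
≢true⇒false {false} _ = refl
≢true⇒false {true}  f = f refl

anyBelow : ℕ → (ℕ → Bool) → Bool
anyBelow zero    f = false
anyBelow (suc n) f = anyBelow n f ∨ f n

anyBelow-true : ∀ {n} f {i} → i < n → f i ≡ true → anyBelow n f ≡ true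
anyBelow-true {suc n} f {i} i<1+n e with m≤n⇒m<n∨m≡n i<1+n
... | inj₁ (s≤s i<n) rewrite anyBelow-true f i<n e = refl
... | inj₂ refl rewrite e = ∨-zeroʳ _

anyBelow-witness : ∀ n f → anyBelow n f ≡ true → ∃[ i ] (i < n × f i ≡ true)
anyBelow-witness (suc n) f e with anyBelow n f in e′
... | true  = let i , i<n , fi = anyBelow-witness n f e′ in i , m<n⇒m<1+n i<n , fi
... | false = n , n<1+n n , e

anyBelow-false : ∀ n f → (∀ i → i < n → f i ≡ true → f i ≡ false) → anyBelow n f ≡ false
anyBelow-false n f none = ≢true⇒false λ e →
  let i , i<n , fi = anyBelow-witness n f e in contradiction (trans (sym fi) (none i i<n fi)) λ ()

-- The base is n + 1 so that raising the exponent never lowers the bound, even at n = 0.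
Polynomial : (ℕ → ℕ) → Set
Polynomial f = ∃[ c ] ∃[ d ] ∀ n → f n ≤ c * suc n ^ d

polynomial-affine : ∀ a b → Polynomial (λ n → a + b * n)
polynomial-affine a b = a + b , 1 , λ n → begin
  a + b * n           ≤⟨ m≤m+n (a + b * n) (a * n + b) ⟩
  a + b * n + (a * n + b) ≡⟨ expand a b n ⟩
  (a + b) * suc n     ≡⟨ cong ((a + b) *_) (*-identityʳ (suc n)) ⟨
  (a + b) * suc n ^ 1 ∎
  where
  open ≤-Reasoning
  expand : ∀ a b n → a + b * n + (a * n + b) ≡ (a + b) * suc n
  expand = solve-∀

polynomial-+ : ∀ {f g} → Polynomial f → Polynomial g → Polynomial (λ n → f n + g n)
polynomial-+ {f} {g} (c , d , f≤) (c′ , d′ , g≤) = c + c′ , d + d′ , λ n → begin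
  f n + g n                                     ≤⟨ +-mono-≤ (f≤ n) (g≤ n) ⟩
  c * suc n ^ d + c′ * suc n ^ d′               ≤⟨ +-mono-≤ (*-monoʳ-≤ c (^-monoʳ-≤ (suc n) (m≤m+n d d′)))
                                                             (*-monoʳ-≤ c′ (^-monoʳ-≤ (suc n) (m≤n+m d′ d))) ⟩
  c * suc n ^ (d + d′) + c′ * suc n ^ (d + d′)  ≡⟨ *-distribʳ-+ (suc n ^ (d + d′)) c c′ ⟨
  (c + c′) * suc n ^ (d + d′)                   ∎
  where open ≤-Reasoning

polynomial-* : ∀ {f g} → Polynomial f → Polynomial g → Polynomial (λ n → f n * g n)
polynomial-* {f} {g} (c , d , f≤) (c′ , d′ , g≤) = c * c′ , d + d′ , λ n → begin
  f n * g n                                  ≤⟨ *-mono-≤ (f≤ n) (g≤ n) ⟩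
  (c * suc n ^ d) * (c′ * suc n ^ d′)        ≡⟨ swap c (suc n ^ d) c′ (suc n ^ d′) ⟩
  (c * c′) * (suc n ^ d * suc n ^ d′)        ≡⟨ cong (c * c′ *_) (^-distribˡ-+-* (suc n) d d′) ⟨
  (c * c′) * suc n ^ (d + d′)                ∎
  where
  open ≤-Reasoning
  swap : ∀ c x c′ y → (c * x) * (c′ * y) ≡ (c * c′) * (x * y)
  swap = solve-∀

-- A language of programs on Boolean tracks, and its compilation.

module Language (K : ℕ) where

  Track : Set
  Track = Fin K

  -- Contents of the K tracks of the tape; only the positions below the input length N are stored.
  State : Set
  State = Track → ℕ → Bool

  data Expr : Set where
    const : Bool → Expr
    on    : Track → Expr
    _&_ _or_ : Expr → Expr → Expr

  eval : Expr → (Track → Bool) → Bool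
  eval (const b) f = b
  eval (on t)    f = f t
  eval (e & e′)  f = eval e f ∧ eval e′ f
  eval (e or e′) f = eval e f ∨ eval e′ f

  eval-cong : ∀ e {f g} → (∀ t → f t ≡ g t) → eval e f ≡ eval e g
  eval-cong (const b) f≗g = refl
  eval-cong (on t)    f≗g = f≗g t
  eval-cong (e & e′)  f≗g = cong₂ _∧_ (eval-cong e f≗g) (eval-cong e′ f≗g)
  eval-cong (e or e′) f≗g = cong₂ _∨_ (eval-cong e f≗g) (eval-cong e′ f≗g)

  at : State → ℕ → Track → Bool
  at σ i t = σ t i

  infixr 4 _⨾_
  data Prog : Set where
    skip  : Prog
    set   : Track → Expr → Prog
    shift : Track → Bool → Prog
    _⨾_   : Prog → Prog → Prog
    if-some_then_else_ : Expr → Prog → Prog → Prog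
    loop  : Track → Prog → Prog

  update : State → Track → (ℕ → Bool) → State
  update σ t f t′ = if does (t ≟ t′) then f else σ t′

  shifted : Bool → (ℕ → Bool) → ℕ → Bool
  shifted b f zero    = b
  shifted b f (suc i) = f i

  iter : {A : Set} → ℕ → (A → A) → A → A
  iter zero    f x = x
  iter (suc n) f x = f (iter n f x)

  some : ℕ → Expr → State → Bool
  some N e σ = anyBelow N (λ i → eval e (at σ i))

  -- Puts the marker on position 0. The two nested updates mirror the two sweeps that the compiled
  -- loop begins with.
  startLoop : Track → State → State
  startLoop x σ = update (update σ x (λ _ → false)) x (shifted true (update σ x (λ _ → false) x))

  -- loop x p runs p once per position, the marker x running through the positions.
  ⟦_⟧ : Prog → ℕ → State → State
  ⟦ skip ⟧ N σ      = σ
  ⟦ set t e ⟧ N σ   = update σ t (λ i → eval e (at σ i))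
  ⟦ shift t b ⟧ N σ = update σ t (shifted b (σ t))
  ⟦ p ⨾ q ⟧ N σ     = ⟦ q ⟧ N (⟦ p ⟧ N σ)
  ⟦ if-some e then p else q ⟧ N σ = if some N e σ then ⟦ p ⟧ N σ else ⟦ q ⟧ N σ
  ⟦ loop x p ⟧ N σ  = iter N (λ τ → ⟦ shift x false ⟧ N (⟦ p ⟧ N τ)) (startLoop x σ)

  -- A syntactic guarantee that a track is not written; `spared` turns it into a frame rule.
  spares : Prog → Track → Bool
  spares skip        t = true
  spares (set x _)   t = not (does (x ≟ t))
  spares (shift x _) t = not (does (x ≟ t))
  spares (p ⨾ q)     t = spares p t ∧ spares q t
  spares (if-some _ then p else q) t = spares p t ∧ spares q t
  spares (loop x p)  t = not (does (x ≟ t)) ∧ spares p t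

  -- The compiled loop stops when its marker has left the tape, so a body must not touch the marker
  -- of its own loop.
  wellFormed : Prog → Bool
  wellFormed skip        = true
  wellFormed (set _ _)   = true
  wellFormed (shift _ _) = true
  wellFormed (p ⨾ q)     = wellFormed p ∧ wellFormed q
  wellFormed (if-some _ then p else q) = wellFormed p ∧ wellFormed q
  wellFormed (loop x p)  = spares p x ∧ wellFormed p

  update-spares : ∀ σ t {f} t′ → not (does (t ≟ t′)) ≡ true → update σ t f t′ ≡ σ t′
  update-spares σ t t′ e with does (t ≟ t′)
  ... | false = refl

  update-self : ∀ σ t {f} → update σ t f t ≡ f
  update-self σ t with t ≟ t
  ... | yes _  = refl
  ... | no t≢t = contradiction refl t≢t

  startLoop-self : ∀ x σ i → startLoop x σ x i ≡ (0 ≡ᵇ i)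
  startLoop-self x σ zero    rewrite update-self (update σ x (λ _ → false)) x {shifted true (update σ x (λ _ → false) x)} = refl
  startLoop-self x σ (suc i) rewrite update-self (update σ x (λ _ → false)) x {shifted true (update σ x (λ _ → false) x)}
    | update-self σ x {λ _ → false} = refl

  spared : ∀ p N σ t → spares p t ≡ true → ⟦ p ⟧ N σ t ≡ σ t
  spared skip        N σ t e = refl
  spared (set x _)   N σ t e = update-spares σ x t e
  spared (shift x _) N σ t e = update-spares σ x t e
  spared (p ⨾ q)     N σ t e = let e₁ , e₂ = ∧-split e in
    trans (spared q N (⟦ p ⟧ N σ) t e₂) (spared p N σ t e₁)
  spared (if-some c then p else q) N σ t e with some N c σ
  ... | true  = spared p N σ t (proj₁ (∧-split e))
  ... | false = spared q N σ t (proj₂ (∧-split {spares p t} e))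
  spared (loop x p)  N σ t e = go N
    where
    e₁ = proj₁ (∧-split e)
    e₂ = proj₂ (∧-split {not (does (x ≟ t))} e)
    go : ∀ n → iter n (λ τ → ⟦ shift x false ⟧ N (⟦ p ⟧ N τ)) (startLoop x σ) t ≡ σ t
    go zero    = trans (update-spares (update σ x (λ _ → false)) x t e₁) (update-spares σ x t e₁)
    go (suc n) = trans (update-spares (⟦ p ⟧ N _) x t e₁) (trans (spared p N _ t e₂) (go n))

  module _ (x : Track) (p : Prog) (safe : spares p x ≡ true) (N : ℕ) (σ : State) where

    body : State → State
    body τ = ⟦ shift x false ⟧ N (⟦ p ⟧ N τ)

    marker : ∀ j i → iter j body (startLoop x σ) x i ≡ (j ≡ᵇ i)
    marker zero    i = startLoop-self x σ i
    marker (suc j) i = trans (cong (λ f → f i) (update-self (⟦ p ⟧ N _) x))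
      (trans (cong (λ f → shifted false f i) (spared p N _ x safe)) (onShift i))
      where
      onShift : ∀ i → shifted false (iter j body (startLoop x σ) x) i ≡ (suc j ≡ᵇ i)
      onShift zero    = refl
      onShift (suc i) = marker j i

  Cell : Set
  Cell = Vec Bool K

  open Machine Cell

  enc : ℕ → ℕ → State → List Cell
  enc k zero    σ = []
  enc k (suc n) σ = tabulate (at σ k) ∷ enc (suc k) n σ

  length-enc : ∀ k n σ → length (enc k n σ) ≡ n
  length-enc k zero    σ = refl
  length-enc k (suc n) σ = cong suc (length-enc (suc k) n σ)

  -- With `h i` the bit carried into position i, given in closed form, a whole sweep reduces to one
  -- equation per cell.
  mealy-enc : ∀ m {σ σ′} (h : ℕ → Bool) →
    (∀ i → m (h i) (tabulate (at σ i)) ≡ (h (suc i) , tabulate (at σ′ i))) →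
    ∀ k n → mealy m (h k) (enc k n σ) ≡ (h (k + n) , enc k n σ′)
  mealy-enc m h ok k zero    = cong (λ i → h i , []) (sym (+-identityʳ k))
  mealy-enc m {σ} {σ′} h ok k (suc n) rewrite ok k | mealy-enc m h ok (suc k) n | +-suc k n = refl

  setM : Track → Expr → Mealy
  setM t e b c = b , tabulate (λ t′ → if does (t ≟ t′) then eval e (lookup c) else lookup c t′)

  shiftM : Track → Mealy
  shiftM t b c = lookup c t , tabulate (λ t′ → if does (t ≟ t′) then b else lookup c t′)

  someM : Expr → Mealy
  someM e b c = b ∨ eval e (lookup c) , c

  -- The bit at the end of the last sweep is the machine's answer, and acceptance means that nothing
  -- was found.
  noneM : Expr → Mealy
  noneM e b c = b ∧ not (eval e (lookup c)) , c

  compile : Prog → Code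
  compile skip        = sweep (λ b c → b , c) false
  compile (set t e)   = sweep (setM t e) false
  compile (shift t b) = sweep (shiftM t) b
  compile (p ⨾ q)     = seq (compile p) (compile q)
  compile (if-some e then p else q) = branch (sweep (someM e) false) (compile p) (compile q)
  compile (loop x p)  =
    seq (sweep (setM x (const false)) false)
   (seq (sweep (shiftM x) true)
        (repeat (seq (compile p) (seq (sweep (shiftM x) false) (sweep (someM (on x)) false)))))

  sweepCost : ℕ → ℕ
  sweepCost N = 3 + 2 * N

  cost : Prog → ℕ → ℕ
  cost skip        N = sweepCost N
  cost (set _ _)   N = sweepCost N
  cost (shift _ _) N = sweepCost N
  cost (p ⨾ q)     N = cost p N + cost q N
  cost (if-some _ then p else q) N = sweepCost N + (cost p N + cost q N)
  -- The factor has the shape of `polynomial-affine 1 1`; its surplus round pays for the empty tape,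
  -- where the body still runs once.
  cost (loop _ p)  N = sweepCost N + (sweepCost N + (1 + 1 * N) * (cost p N + (sweepCost N + sweepCost N)))

  cost-polynomial : ∀ p → Polynomial (cost p)
  cost-polynomial skip        = polynomial-affine 3 2
  cost-polynomial (set _ _)   = polynomial-affine 3 2
  cost-polynomial (shift _ _) = polynomial-affine 3 2
  cost-polynomial (p ⨾ q)     = polynomial-+ (cost-polynomial p) (cost-polynomial q)
  cost-polynomial (if-some _ then p else q) =
    polynomial-+ (polynomial-affine 3 2) (polynomial-+ (cost-polynomial p) (cost-polynomial q))
  cost-polynomial (loop _ p)  = polynomial-+ (polynomial-affine 3 2) (polynomial-+ (polynomial-affine 3 2)
    (polynomial-* (polynomial-affine 1 1)
      (polynomial-+ (cost-polynomial p) (polynomial-+ (polynomial-affine 3 2) (polynomial-affine 3 2)))))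

  Exec-mealy : ∀ {m b N σ b′ σ′} → mealy m b (enc 0 N σ) ≡ (b′ , enc 0 N σ′) →
               Exec (sweep m b) (sweepCost N) (enc 0 N σ) b′ (enc 0 N σ′)
  Exec-mealy {m} {b} {N} {σ} e with Exec-sweep m b (enc 0 N σ)
  ... | run rewrite e | length-enc 0 N σ = run

  Exec-set : ∀ t e b N σ → Exec (sweep (setM t e) b) (sweepCost N) (enc 0 N σ) b (enc 0 N (⟦ set t e ⟧ N σ))
  Exec-set t e b N σ = Exec-mealy (mealy-enc _ (λ _ → b) (λ i → cong (b ,_) (tabulate-cong (agrees i))) 0 N)
    where
    agrees : ∀ i t′ → (if does (t ≟ t′) then eval e (lookup (tabulate (at σ i))) else lookup (tabulate (at σ i)) t′)
                      ≡ update σ t (λ i → eval e (at σ i)) t′ i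
    agrees i t′ with does (t ≟ t′)
    ... | true  = eval-cong e (lookup∘tabulate (at σ i))
    ... | false = lookup∘tabulate (at σ i) t′

  Exec-shift : ∀ t b N σ → ∃[ b′ ] Exec (sweep (shiftM t) b) (sweepCost N) (enc 0 N σ) b′ (enc 0 N (⟦ shift t b ⟧ N σ))
  Exec-shift t b N σ = _ , Exec-mealy (mealy-enc _ (shifted b (σ t))
      (λ i → cong₂ _,_ (lookup∘tabulate (at σ i) t) (tabulate-cong (agrees i))) 0 N)
    where
    agrees : ∀ i t′ → (if does (t ≟ t′) then shifted b (σ t) i else lookup (tabulate (at σ i)) t′)
                      ≡ update σ t (shifted b (σ t)) t′ i
    agrees i t′ with does (t ≟ t′)
    ... | true  = refl
    ... | false = lookup∘tabulate (at σ i) t′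

  Exec-some : ∀ e N σ → Exec (sweep (someM e) false) (sweepCost N) (enc 0 N σ) (some N e σ) (enc 0 N σ)
  Exec-some e N σ = Exec-mealy (mealy-enc _ (λ n → some n e σ)
    (λ i → cong (λ b → some i e σ ∨ b , _) (eval-cong e (lookup∘tabulate (at σ i)))) 0 N)

  Exec-none : ∀ e N σ → Exec (sweep (noneM e) true) (sweepCost N) (enc 0 N σ) (not (some N e σ)) (enc 0 N σ)
  Exec-none e N σ = Exec-mealy (mealy-enc _ (λ n → not (some n e σ)) (λ i → cong₂ _,_ (agrees i) refl) 0 N)
    where
    agrees : ∀ i → not (some i e σ) ∧ not (eval e (lookup (tabulate (at σ i)))) ≡ not (some (suc i) e σ)
    agrees i rewrite eval-cong e (lookup∘tabulate (at σ i)) with some i e σ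
    ... | true  = refl
    ... | false = refl

  Exec-skip : ∀ N σ → Exec (sweep (λ b c → b , c) false) (sweepCost N) (enc 0 N σ) false (enc 0 N σ)
  Exec-skip N σ = Exec-mealy (mealy-enc _ (λ _ → false) (λ i → refl) 0 N)

  compile-correct : ∀ p → wellFormed p ≡ true → ∀ N σ →
    ∃[ b ] Exec (compile p) (cost p N) (enc 0 N σ) b (enc 0 N (⟦ p ⟧ N σ))
  compile-correct skip        wf N σ = _ , Exec-skip N σ
  compile-correct (set t e)   wf N σ = _ , Exec-set t e false N σ
  compile-correct (shift t b) wf N σ = Exec-shift t b N σ
  compile-correct (p ⨾ q)     wf N σ =
    let wf₁ , wf₂ = ∧-split wf
        _ , run₁ = compile-correct p wf₁ N σ
        _ , run₂ = compile-correct q wf₂ N (⟦ p ⟧ N σ)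
    in _ , Exec-seq run₁ run₂
  compile-correct (if-some e then p else q) wf N σ with some N e σ | Exec-some e N σ
  ... | true  | test =
    let _ , run = compile-correct p (proj₁ (∧-split wf)) N σ
    in _ , Exec-weaken (+-monoʳ-≤ (sweepCost N) (m≤m+n (cost p N) (cost q N))) (Exec-branch-true test run)
  ... | false | test =
    let _ , run = compile-correct q (proj₂ (∧-split {wellFormed p} wf)) N σ
    in _ , Exec-weaken (+-monoʳ-≤ (sweepCost N) (m≤n+m (cost q N) (cost p N))) (Exec-branch-false test run)
  compile-correct (loop x p) wf N σ =
    _ , Exec-seq (Exec-set x (const false) false N σ)
          (Exec-seq (proj₂ (Exec-shift x true N (⟦ set x (const false) ⟧ N σ))) (rounds N refl))
    where
    safe : spares p x ≡ true
    safe = proj₁ (∧-split wf)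
    states : ℕ → State
    states j = iter j (body x p safe N σ) (startLoop x σ)
    roundCode : Code
    roundCode = seq (compile p) (seq (sweep (shiftM x) false) (sweep (someM (on x)) false))
    roundCost : ℕ
    roundCost = cost p N + (sweepCost N + sweepCost N)
    round : ∀ j → Exec roundCode roundCost (enc 0 N (states j)) (some N (on x) (states (suc j))) (enc 0 N (states (suc j)))
    round j = Exec-seq (proj₂ (compile-correct p (proj₂ (∧-split {spares p x} wf)) N (states j)))
      (Exec-seq (proj₂ (Exec-shift x false N (⟦ p ⟧ N (states j)))) (Exec-some (on x) N (states (suc j))))
    continue : ∀ j → suc j < N → some N (on x) (states (suc j)) ≡ true
    continue j lt = anyBelow-true (λ i → states (suc j) x i) lt (trans (marker x p safe N σ (suc j) (suc j)) (≡ᵇ-refl j))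
    -- After N rounds the marker stands at position N, just off the tape.
    stop : some N (on x) (states N) ≡ false
    stop = anyBelow-false N (λ i → states N x i) λ i i<N e →
      contradiction (≡ᵇ-true⇒≡ N i (trans (sym (marker x p safe N σ N i)) e)) (>⇒≢ i<N)
    loopFrom : ∀ r j → j + suc r ≡ N →
      Exec (repeat roundCode) (suc r * roundCost) (enc 0 N (states j)) false (enc 0 N (states N))
    loopFrom zero    j e =
      Exec-weaken (≤-reflexive (sym (+-identityʳ roundCost)))
        (Exec-exit (subst₂ (λ b n → Exec roundCode roundCost (enc 0 N (states j)) b (enc 0 N (states n)))
          (trans (cong (λ n → some N (on x) (states n)) last) stop) last (round j)))
      where
      last : suc j ≡ N
      last = trans (+-comm 1 j) e
    loopFrom (suc r) j e =
      Exec-repeat (subst (λ b → Exec roundCode roundCost (enc 0 N (states j)) b (enc 0 N (states (suc j))))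
        (continue j (≤-trans (s≤s (s≤s (m≤m+n j r))) (≤-reflexive (trans (sym (trans (+-suc j (suc r)) (cong suc (+-suc j r)))) e))))
        (round j)) (loopFrom r (suc j) (trans (sym (+-suc j (suc r))) e))
    -- On the empty input the compiled loop runs its body once instead of never; there are no cells to change.
    rounds : ∀ n → n ≡ N →
      Exec (repeat roundCode) ((1 + 1 * N) * roundCost) (enc 0 N (startLoop x σ)) false (enc 0 N (states N))
    rounds zero    refl = Exec-weaken (≤-reflexive (sym (+-identityʳ roundCost))) (Exec-exit (round 0))
    rounds (suc r) refl = Exec-weaken (*-monoˡ-≤ roundCost (≤-trans (≤-reflexive (sym (*-identityˡ (suc r)))) (n≤1+n (1 * suc r))))
      (loopFrom r 0 refl)

  -- Proof rules for loops.

  Agree : Prog → State → State → Set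
  Agree p τ σ = ∀ t → spares p t ≡ true → τ t ≡ σ t

  -- `Agree` supplies at every round that the tracks not written by the loop have their initial
  -- contents, so `I` need only speak of the others.
  loop-rule : ∀ x p N σ → spares p x ≡ true → (I : ℕ → State → Set) → I 0 (startLoop x σ) →
    (∀ j τ → j < N → Agree (loop x p) τ σ → (∀ i → τ x i ≡ (j ≡ᵇ i)) → I j τ →
       I (suc j) (⟦ shift x false ⟧ N (⟦ p ⟧ N τ))) →
    I N (⟦ loop x p ⟧ N σ)
  loop-rule x p N σ safe I base ind = go N ≤-refl
    where
    states : ℕ → State
    states j = iter j (body x p safe N σ) (startLoop x σ)
    agree : ∀ j → Agree (loop x p) (states j) σ
    agree zero    t e = let e₁ , _ = ∧-split e in
      trans (update-spares (update σ x (λ _ → false)) x t e₁) (update-spares σ x t e₁)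
    agree (suc j) t e = let e₁ , e₂ = ∧-split {not (does (x ≟ t))} e in
      trans (update-spares (⟦ p ⟧ N _) x t e₁) (trans (spared p N _ t e₂) (agree j t e))
    go : ∀ j → j ≤ N → I j (states j)
    go zero    _   = base
    go (suc j) j<N = ind j (states j) j<N (agree j) (marker x p safe N σ j) (go j (<⇒≤ j<N))

  when : Expr → Prog → Prog
  when e p = if-some e then p else skip

  if-true : ∀ e p q N σ → some N e σ ≡ true → ⟦ if-some e then p else q ⟧ N σ ≡ ⟦ p ⟧ N σ
  if-true e p q N σ h = cong (if_then ⟦ p ⟧ N σ else ⟦ q ⟧ N σ) h

  if-false : ∀ e p q N σ → some N e σ ≡ false → ⟦ if-some e then p else q ⟧ N σ ≡ ⟦ q ⟧ N σ
  if-false e p q N σ h = cong (if_then ⟦ p ⟧ N σ else ⟦ q ⟧ N σ) h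

  if-elim : ∀ (P : State → Set) e p q N σ → (some N e σ ≡ true → P (⟦ p ⟧ N σ)) → (some N e σ ≡ false → P (⟦ q ⟧ N σ)) →
            P (⟦ if-some e then p else q ⟧ N σ)
  if-elim P e p q N σ ifTrue ifFalse with some N e σ
  ... | true  = ifTrue refl
  ... | false = ifFalse refl

  -- An initial segment marked on track `l` is a unary number. The body runs while the marker lies
  -- inside it, hence that many times.
  times : Track → Track → Prog → Prog
  times x l p = loop x (when (on x & on l) p)

  Prefix : ℕ → (ℕ → Bool) → ℕ → Set
  Prefix N f k = ∀ i → i < N → f i ≡ (i <ᵇ k)

  -- After j rounds of the underlying loop the body has run j ⊓ k times, and `J` is kept at that
  -- index. The marker also moves in idle rounds, so `J` must be insensitive to it.
  times-rule : ∀ x l p N σ {k} → spares p x ≡ true → spares (times x l p) l ≡ true → k ≤ N → Prefix N (σ l) k →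
    (J : ℕ → State → Set) → (∀ j τ f → J j τ → J j (update τ x f)) → J 0 σ →
    (∀ j τ → j < k → Agree (times x l p) τ σ → J j τ → J (suc j) (⟦ p ⟧ N τ)) →
    J k (⟦ times x l p ⟧ N σ)
  times-rule x l p N σ {k} safe safe′ k≤N prefix J insensitive base ind =
    subst (λ n → J n (⟦ times x l p ⟧ N σ)) (m≥n⇒m⊓n≡n k≤N)
      (loop-rule x (when (on x & on l) p) N σ (cong (_∧ true) safe) (λ j τ → J (j ⊓ k) τ)
        (insensitive 0 _ _ (insensitive 0 _ _ base)) round)
    where
    idle : ∀ {j τ} → Agree (times x l p) τ σ → (∀ i → τ x i ≡ (j ≡ᵇ i)) → ¬ j < k →
           ∀ i → i < N → τ x i ∧ τ l i ≡ true → τ x i ∧ τ l i ≡ false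
    idle {j} agree mark j≮k i i<N e =
      let ex , el = ∧-split e
          j≡i = ≡ᵇ-true⇒≡ j i (trans (sym (mark i)) ex)
          i<k = <ᵇ-true⇒< i k (trans (sym (trans (cong (λ f → f i) (agree l safe′)) (prefix i i<N))) el)
      in contradiction (subst (_< k) (sym j≡i) i<k) j≮k
    round : ∀ j τ → j < N → Agree (times x l p) τ σ → (∀ i → τ x i ≡ (j ≡ᵇ i)) → J (j ⊓ k) τ →
            J (suc j ⊓ k) (⟦ shift x false ⟧ N (⟦ when (on x & on l) p ⟧ N τ))
    round j τ j<N agree mark Jj with j <? k
    ... | yes j<k rewrite anyBelow-true (λ i → τ x i ∧ τ l i) j<N
            (cong₂ _∧_ (trans (mark j) (≡ᵇ-refl j))
                       (trans (cong (λ f → f j) (agree l safe′)) (trans (prefix j j<N) (exceeds j<k))))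
          | m≤n⇒m⊓n≡m j<k = insensitive (suc j) _ _ (ind j τ j<k agree (subst (λ n → J n τ) (m≤n⇒m⊓n≡m (<⇒≤ j<k)) Jj))
    ... | no j≮k rewrite anyBelow-false N (λ i → τ x i ∧ τ l i) (idle agree mark j≮k)
          | m≥n⇒m⊓n≡n (m≤n⇒m≤1+n (≮⇒≥ j≮k)) = insensitive k _ _ (subst (λ n → J n τ) (m≥n⇒m⊓n≡n (≮⇒≥ j≮k)) Jj)

-- Obstructions, and the cycles they close up to.

module Obstructions {s : ℕ} (G : BipartiteGraph s) where

  E : Fin s → Fin s → Bool
  E = adj G

  E-sym : ∀ {u v b} → E u v ≡ b → E v u ≡ b
  E-sym {u} {v} e = trans (BipartiteGraph.sym G v u) e

  true≢false : ∀ {b} → b ≡ true → b ≡ false → ∀ {A : Set} → A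
  true≢false refl ()

  -- Idling is allowed, which gives monotonicity in the bound. Only entered vertices are tested
  -- against b: the start a of an obstruction is itself a neighbour of b.
  Reach : Fin s → Fin s → ℕ → Fin s → Set
  Reach a b zero    v = v ≡ a
  Reach a b (suc m) v = Reach a b m v ⊎ (E v b ≡ false × ∃[ u ] (Reach a b m u × E u v ≡ true))

  Reach-mono : ∀ {a b m n v} → m ≤ n → Reach a b m v → Reach a b n v
  Reach-mono {n = zero}  z≤n r = r
  Reach-mono {m = m} {suc n} m≤1+n r with m≤n⇒m<n∨m≡n m≤1+n
  ... | inj₁ (s≤s m≤n) = inj₁ (Reach-mono m≤n r)
  ... | inj₂ refl      = r

  Obstruction : ℕ → Fin s → Fin s → Fin s → Fin s → Set
  Obstruction m a b c d = E a b ≡ true × E b c ≡ true × Reach a b m d × E d c ≡ true × E d a ≡ false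

  -- The breadth-first layers of `Reach`.
  Layer : Fin s → Fin s → ℕ → Fin s → Set
  Layer a b zero    v = v ≡ a
  Layer a b (suc m) v = Reach a b (suc m) v × ¬ Reach a b m v

  Layer⇒Reach : ∀ {a b} m {v} → Layer a b m v → Reach a b m v
  Layer⇒Reach zero    r = r
  Layer⇒Reach (suc m) l = proj₁ l

  Layer-minimal : ∀ {a b} i j {v} → Layer a b j v → Reach a b i v → j ≤ i
  Layer-minimal i zero    _       _ = z≤n
  Layer-minimal i (suc j) (_ , ¬r) r = ≰⇒> λ i≤j → ¬r (Reach-mono i≤j r)

  Layer-avoids : ∀ {a b} k {v} → Layer a b (suc k) v → E v b ≡ false
  Layer-avoids k (inj₁ r , ¬r)      = contradiction r ¬r
  Layer-avoids k (inj₂ (av , _) , _) = av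

  -- A vertex beyond layer 0 has been entered, so it avoids b and every edge from layer i into it is
  -- a legal step.
  Layer-step : ∀ {a b} i j {u v} → Layer a b i u → Layer a b j v → E u v ≡ true → j ≤ suc i
  Layer-step i zero    _  _  _ = z≤n
  Layer-step i (suc j) lu lv e =
    Layer-minimal (suc i) (suc j) lv (inj₂ (Layer-avoids j lv , _ , Layer⇒Reach i lu , e))

  -- Had the predecessor been reached earlier, v would have been too.
  Layer-pred : ∀ {a b} m {v} → Layer a b (suc m) v → ∃[ u ] (Layer a b m u × E u v ≡ true)
  Layer-pred m       (inj₁ r , ¬r) = contradiction r ¬r
  Layer-pred zero    (inj₂ (_ , u , r , e) , _) = u , r , e
  Layer-pred (suc m) (inj₂ (av , u , r , e) , ¬r) = u , (r , λ r′ → ¬r (inj₂ (av , u , r′ , e))) , e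

  record ShortestPath (a b : Fin s) (m : ℕ) (v : Fin s) : Set where
    field
      at     : ℕ → Fin s
      last   : at m ≡ v
      layers : ∀ i → i ≤ m → Layer a b i (at i)
      edges  : ∀ i → i < m → E (at i) (at (suc i)) ≡ true

  shortestPath : ∀ {a b} m {v} → Layer a b m v → ShortestPath a b m v
  shortestPath zero {v} l = record
    { at = λ _ → v ; last = refl ; layers = λ { zero z≤n → l } ; edges = λ _ () }
  shortestPath {a} {b} (suc m) {v} l with Layer-pred m l
  ... | u , l′ , e = record { at = at ; last = last ; layers = layers ; edges = edges }
    where
    open ShortestPath (shortestPath m l′) renaming (at to at′; last to last′; layers to layers′; edges to edges′)
    at : ℕ → Fin s
    at i with i ≤? m
    ... | yes _ = at′ i
    ... | no  _ = v
    last : at (suc m) ≡ v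
    last with suc m ≤? m
    ... | yes lt = contradiction lt (<-irrefl refl)
    ... | no  _  = refl
    layers : ∀ i → i ≤ suc m → Layer a b i (at i)
    layers i i≤ with i ≤? m
    ... | yes i≤m = layers′ i i≤m
    ... | no  i≰m = subst (λ j → Layer a b j v) (≤-antisym (≰⇒> i≰m) i≤) l
    edges : ∀ i → i < suc m → E (at i) (at (suc i)) ≡ true
    edges i (s≤s i≤m) with i ≤? m | suc i ≤? m
    ... | no i≰m | _      = contradiction i≤m i≰m
    ... | yes _  | yes lt = edges′ i lt
    ... | yes _  | no i≮m with ≤-antisym i≤m (≮⇒≥ i≮m)
    ... | refl = trans (cong (λ x → E x v) last′) e

  -- A shortest path at from a to the first eligible d closes up through c and b to a cycle whose
  -- only possible chord joins c to the second vertex of the path.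
  module Shortest {m a b c d} (ob : Obstruction m a b c d)
                  (least : ∀ k d′ → k < m → ¬ Obstruction k a b c d′) where

    ab : E a b ≡ true
    ab = proj₁ ob
    bc : E b c ≡ true
    bc = proj₁ (proj₂ ob)
    dc : E d c ≡ true
    dc = proj₁ (proj₂ (proj₂ (proj₂ ob)))
    da : E d a ≡ false
    da = proj₂ (proj₂ (proj₂ (proj₂ ob)))

    top : Layer a b m d
    top = go m (proj₁ (proj₂ (proj₂ ob))) least
      where
      go : ∀ m → Reach a b m d → (∀ k d′ → k < m → ¬ Obstruction k a b c d′) → Layer a b m d
      go zero    r least = r
      go (suc m) r least = r , λ r′ → least m d ≤-refl (ab , bc , r′ , dc , da)

    open ShortestPath (shortestPath m top)

    start : at 0 ≡ a
    start = layers 0 z≤n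

    opposite : ∀ {u v} → E u v ≡ true → side G u ≡ not (side G v)
    opposite {u} {v} = bip G u v

    same : ∀ {u v w} → E u v ≡ true → E v w ≡ true → side G u ≡ side G w
    same e e′ = trans (opposite e) (trans (cong not (opposite e′)) (Bool.not-involutive _))

    aligned⇒¬E : ∀ {u v} → side G u ≡ side G v → E u v ≡ true → ∀ {A : Set} → A
    aligned⇒¬E eq e = contradiction (trans (sym eq) (opposite e)) (Bool.not-¬ refl)

    -- Lengths 0 and 2 put d on the side of a, which is also that of c, against the edge dc; length
    -- 1 makes d adjacent to a.
    long : 3 ≤ m
    long = go m last edges layers
      where
      go : ∀ k → at k ≡ d → (∀ i → i < k → E (at i) (at (suc i)) ≡ true) →
           (∀ i → i ≤ k → Layer a b i (at i)) → 3 ≤ k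
      go 0 e _ _ = aligned⇒¬E (same ab bc) (trans (cong (λ x → E x c) (trans (sym start) e)) dc)
      go 1 e st _ = true≢false (trans (sym (cong₂ E start e)) (st 0 ≤-refl)) (E-sym da)
      go 2 e st _ = aligned⇒¬E (trans (sym (trans (sym (cong (side G) start)) (trans
        (same (st 0 (s≤s z≤n)) (st 1 ≤-refl)) (cong (side G) e)))) (same ab bc)) dc
      go (suc (suc (suc k))) _ _ _ = s≤s (s≤s (s≤s z≤n))

    b-free : ∀ k → suc k ≤ m → E (at (suc k)) b ≡ false
    b-free k lt = Layer-avoids k (layers (suc k) lt)

    -- Vertex 0 is on the side of c. From index 2 on, a neighbour of c would be an earlier eligible
    -- d, unless adjacent to a; but neighbours of a on the path lie in layer 1.
    c-free : ∀ k → k < m → k ≢ 1 → E (at k) c ≡ true → ∀ {A : Set} → A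
    c-free zero _ _ e = aligned⇒¬E (same ab bc) (trans (cong (λ x → E x c) (sym start)) e)
    c-free (suc zero) _ k≢1 _ = contradiction refl k≢1
    c-free (suc (suc k)) lt _ e with E (at (suc (suc k))) a in adjacent
    ... | false = contradiction (ab , bc , Layer⇒Reach (suc (suc k)) (layers _ (<⇒≤ lt)) , e , adjacent)
                                (least _ _ lt)
    ... | true  = contradiction (Layer-step 0 (suc (suc k)) (layers 0 z≤n) (layers _ (<⇒≤ lt))
                    (trans (cong (λ x → E x (at (suc (suc k)))) start) (E-sym adjacent))) λ { (s≤s ()) }

    -- d tells c from a, and b tells c from every later vertex.
    c∉path : ∀ k → k ≤ m → c ≢ at k
    c∉path zero    _  e = true≢false (trans (cong (E d) (sym (trans e start))) dc) da
    c∉path (suc k) le e = true≢false (trans (cong (λ x → E x b) (sym e)) (E-sym bc)) (b-free k le)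

    -- The successor of b on the path would be a neighbour of b; and b cannot be the last vertex d,
    -- since b is adjacent to a.
    b∉path : ∀ k → k ≤ m → b ≢ at k
    b∉path zero _ e = aligned⇒¬E (cong (side G) (sym (trans e start))) ab
    b∉path (suc k) le e with m≤n⇒m<n∨m≡n le
    ... | inj₁ lt   = true≢false (E-sym (trans (cong (λ x → E x (at (suc (suc k)))) e) (edges (suc k) lt))) (b-free (suc k) lt)
    ... | inj₂ refl = true≢false (trans (cong (λ x → E x a) (sym (trans e last))) (E-sym ab)) da

    cycle : Fin (suc (suc (suc m))) → Fin s
    cycle fzero           = c
    cycle (fsuc fzero)    = b
    cycle (fsuc (fsuc i)) = at (toℕ i)

    bound : ∀ (i : Fin (suc m)) → toℕ i ≤ m
    bound i = toℕ≤pred[n] i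

    isCycle : IsCycle G (suc (suc m)) cycle
    isCycle .IsCycle.distinct {fzero} {fzero} e = refl
    isCycle .IsCycle.distinct {fzero} {fsuc fzero} e = aligned⇒¬E (cong (side G) (sym e)) bc
    isCycle .IsCycle.distinct {fzero} {fsuc (fsuc j)} e = contradiction e (c∉path _ (bound j))
    isCycle .IsCycle.distinct {fsuc fzero} {fzero} e = aligned⇒¬E (cong (side G) e) bc
    isCycle .IsCycle.distinct {fsuc fzero} {fsuc fzero} e = refl
    isCycle .IsCycle.distinct {fsuc fzero} {fsuc (fsuc j)} e = contradiction e (b∉path _ (bound j))
    isCycle .IsCycle.distinct {fsuc (fsuc i)} {fzero} e = contradiction (sym e) (c∉path _ (bound i))
    isCycle .IsCycle.distinct {fsuc (fsuc i)} {fsuc fzero} e = contradiction (sym e) (b∉path _ (bound i))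
    isCycle .IsCycle.distinct {fsuc (fsuc i)} {fsuc (fsuc j)} e =
      cong (λ k → fsuc (fsuc k)) (toℕ-injective (≤-antisym
        (below i j e) (below j i (sym e))))
      where
      below : ∀ (i j : Fin (suc m)) → at (toℕ i) ≡ at (toℕ j) → toℕ i ≤ toℕ j
      below i j e = Layer-minimal (toℕ j) (toℕ i) (layers _ (bound i))
        (subst (Reach a b (toℕ j)) (sym e) (Layer⇒Reach (toℕ j) (layers _ (bound j))))
    isCycle .IsCycle.step fzero               = E-sym bc
    isCycle .IsCycle.step (fsuc fzero)        = E-sym (trans (cong (λ x → E x b) start) ab)
    isCycle .IsCycle.step (fsuc (fsuc i))     =
      trans (cong (λ k → E (at k) (at (suc (toℕ i)))) (toℕ-inject₁ i)) (edges (toℕ i) (toℕ<n i))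
    isCycle .IsCycle.closing = trans (cong (λ x → E x c) (trans (cong at (toℕ-fromℕ m)) last)) dc

    -- The cycle lists c, b and then the path, so index 3 is the second path vertex. Layers exclude
    -- chords inside the path, and avoidance excludes chords at b.
    onlyChord : ∀ i j → Chord G (suc (suc m)) cycle i j → i ≡ fzero × toℕ j ≡ 3
    onlyChord fzero (fsuc fzero) (_ , _ , ≢1 , _) = contradiction refl ≢1
    onlyChord fzero (fsuc (fsuc j)) (_ , e , _ , inner) with toℕ j Data.Nat.≟ 1
    ... | yes j≡1 = refl , cong (λ k → suc (suc k)) j≡1
    ... | no  j≢1 = c-free (toℕ j) (≤∧≢⇒< (bound j) λ j≡m → inner (refl , cong (λ k → suc (suc k)) j≡m)) j≢1 (E-sym e)
    onlyChord (fsuc fzero) (fsuc fzero) (s≤s () , _)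
    onlyChord (fsuc fzero) (fsuc (fsuc fzero)) (_ , _ , ≢2 , _) = contradiction refl ≢2
    onlyChord (fsuc fzero) (fsuc (fsuc (fsuc j))) (_ , e , _) = true≢false (E-sym e) (b-free (toℕ j) (bound (fsuc j)))
    onlyChord (fsuc (fsuc i)) (fsuc fzero) (s≤s () , _)
    onlyChord (fsuc (fsuc i)) (fsuc (fsuc j)) (s≤s (s≤s i<j) , e , ≢suc , _) =
      contradiction (≤-antisym (Layer-step (toℕ i) (toℕ j) (layers _ (bound i)) (layers _ (bound j)) e) i<j)
                    (λ eq → ≢suc (cong (λ k → suc (suc k)) eq))

    refutes : ¬ TwoChordalBipartite G
    refutes two with two (suc (suc m)) cycle (s≤s (s≤s (s≤s long))) isCycle
    ... | i , j , i′ , j′ , ch , ch′ , differ with onlyChord i j ch | onlyChord i′ j′ ch′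
    ... | i≡0 , j≡3 | i′≡0 , j′≡3 with differ
    ... | inj₁ i≢i′ = i≢i′ (trans i≡0 (sym i′≡0))
    ... | inj₂ j≢j′ = j≢j′ (toℕ-injective (trans j≡3 (sym j′≡3)))

  -- Induction replaces the choice of a least obstruction: a shorter one with the same a, b, c
  -- already refutes the property, so none need be considered.
  obstruction⇒¬two : ∀ m a b c d → Obstruction m a b c d → ¬ TwoChordalBipartite G
  obstruction⇒¬two = <-rec (λ m → ∀ a b c d → Obstruction m a b c d → ¬ TwoChordalBipartite G)
    λ m rec a b c d ob two → Shortest.refutes ob (λ k d′ k<m ob′ → rec k<m a b c d′ ob′ two) two

  -- From a cycle with at most one chord to an obstruction.

  module Cycle (n : ℕ) (c : Fin (suc n) → Fin s) (6≤ : 6 ≤ suc n) (cyc : IsCycle G n c)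
               (N : ℕ) (2s≤N : s + s ≤ N) (free : ∀ a b v d → ¬ Obstruction N a b v d) where

    Chord? : ∀ i j → Dec (Chord G n c i j)
    Chord? i j = (toℕ i Data.Nat.<? toℕ j) ×-dec (E (c i) (c j) Bool.≟ true)
      ×-dec ¬? (toℕ j Data.Nat.≟ suc (toℕ i)) ×-dec ¬? ((toℕ i Data.Nat.≟ 0) ×-dec (toℕ j Data.Nat.≟ n))

    vertex : ∀ {k} → k ≤ n → Fin s
    vertex k≤n = c (fromℕ< (s≤s k≤n))

    vertex-toℕ : ∀ i {k} (k≤n : k ≤ n) → toℕ i ≡ k → c i ≡ vertex k≤n
    vertex-toℕ i k≤n e = cong c (toℕ-injective (trans e (sym (toℕ-fromℕ< (s≤s k≤n)))))

    vertex-step : ∀ {k} (lt : suc k ≤ n) → E (vertex (<⇒≤ lt)) (vertex lt) ≡ true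
    vertex-step {k} lt = trans (sym (cong₂ E
      (vertex-toℕ (inject₁ i) (<⇒≤ lt) (trans (toℕ-inject₁ i) (toℕ-fromℕ< lt)))
      (vertex-toℕ (fsuc i) lt (cong suc (toℕ-fromℕ< lt))))) (IsCycle.step cyc i)
      where i = fromℕ< lt

    vertex-closing : E (vertex {n} ≤-refl) (vertex z≤n) ≡ true
    vertex-closing = trans (sym (cong₂ E (vertex-toℕ (fromℕ n) ≤-refl (toℕ-fromℕ n)) refl)) (IsCycle.closing cyc)

    vertex-chord : ∀ {i j} (i≤n : i ≤ n) (j≤n : j ≤ n) → i < j → E (vertex i≤n) (vertex j≤n) ≡ true →
      j ≢ suc i → ¬ (i ≡ 0 × j ≡ n) → Chord G n c (fromℕ< (s≤s i≤n)) (fromℕ< (s≤s j≤n))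
    vertex-chord i≤n j≤n i<j e j≢ inner
      rewrite toℕ-fromℕ< (s≤s i≤n) | toℕ-fromℕ< (s≤s j≤n) = i<j , e , j≢ , inner

    -- b = c_{t+1} carries no chord and neither does the pair a = c_{t+2}, d = c_{t-1}, so going round
    -- the cycle from a to d exhibits an obstruction.
    module Pivot (t : ℕ) (t+2≤n : suc (suc t) ≤ n) (pivot : ∀ i j → Chord G n c i j → toℕ i ≡ t) where

      t+1≤n : suc t ≤ n
      t+1≤n = <⇒≤ t+2≤n

      a = vertex t+2≤n
      b = vertex t+1≤n

      off-pivot : ∀ {i j} (i≤n : i ≤ n) (j≤n : j ≤ n) → i < j → i ≢ t → j ≢ suc i → ¬ (i ≡ 0 × j ≡ n) →
                  E (vertex i≤n) (vertex j≤n) ≡ false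
      off-pivot i≤n j≤n i<j i≢t j≢ inner with E (vertex i≤n) (vertex j≤n) in e
      ... | false = refl
      ... | true  = contradiction
        (trans (sym (toℕ-fromℕ< (s≤s i≤n))) (pivot _ _ (vertex-chord i≤n j≤n i<j e j≢ inner))) i≢t

      late : ∀ k (le : k ≤ n) → suc (suc t) ≤ k → Reach a b k (vertex le)
      late (suc k) le 2+t≤1+k with m≤n⇒m<n∨m≡n 2+t≤1+k
      ... | inj₂ refl = Reach-mono {m = 0} z≤n (cong (λ q → vertex q) (≤-irrelevant le t+2≤n))
      ... | inj₁ (s≤s 2+t≤k) = inj₂
        ( E-sym (off-pivot t+1≤n le (m<n⇒m<1+n 2+t≤k) (λ e → <-irrefl (sym e) ≤-refl)
            (λ e → <-irrefl (sym (cong pred e)) 2+t≤k) (λ { (() , _) }))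
        , vertex (<⇒≤ le) , late k (<⇒≤ le) 2+t≤k , vertex-step le)

      -- Past the closing edge the indices continue from n + 1. In the pair with b the smaller index
      -- is now k, still different from t.
      early : ∀ k (le : k ≤ n) → k < t → Reach a b (suc n + k) (vertex le)
      early zero le 0<t rewrite +-identityʳ n = inj₂
        ( off-pivot le t+1≤n (s≤s z≤n) (<⇒≢ 0<t) (λ e → <⇒≢ 0<t (sym (cong pred e)))
            (λ { (_ , e) → <-irrefl e t+2≤n })
        , vertex {n} ≤-refl , late n ≤-refl t+2≤n
        , trans (cong (λ q → E _ (vertex q)) (≤-irrelevant le z≤n)) vertex-closing)
      early (suc k) le lt rewrite +-suc n k = inj₂
        ( off-pivot le t+1≤n (m<n⇒m<1+n lt) (<⇒≢ lt) (λ e → <⇒≢ lt (sym (cong pred e))) (λ { (() , _) })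
        , vertex (<⇒≤ le) , early k (<⇒≤ le) (<⇒≤ lt) , vertex-step le)

      1+n≤s : suc n ≤ s
      1+n≤s = injective⇒≤ (IsCycle.distinct cyc)

      -- For t = 0 the predecessor of c is the last vertex, and the walk ends before the closing
      -- edge; otherwise it must cross that edge.
      absurd : ∀ t′ → t′ ≡ t → ∀ {A : Set} → A
      absurd zero e = contradiction
        ( E-sym (vertex-step t+2≤n) , E-sym (vertex-step t+1≤n)
        , Reach-mono (≤-trans (≤-trans (n≤1+n n) 1+n≤s) (≤-trans (m≤m+n s s) 2s≤N)) (late n ≤-refl t+2≤n)
        , subst (λ k → ∀ (le : k ≤ n) → E (vertex {n} ≤-refl) (vertex le) ≡ true) e (λ le → trans (cong (λ q → E _ (vertex q)) (≤-irrelevant le z≤n)) vertex-closing) (<⇒≤ t+1≤n)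
        , E-sym (off-pivot t+2≤n ≤-refl (≤-trans (s≤s (s≤s (s≤s (≤-reflexive (sym e))))) (≤-trans (s≤s (s≤s (s≤s z≤n))) (s≤s⁻¹ 6≤)))
            (λ eq → <-irrefl (sym eq) (m<n⇒m<1+n ≤-refl))
            (λ eq → <-irrefl (trans (cong (λ k → suc (suc (suc k))) e) (sym eq)) (≤-trans (s≤s (s≤s (s≤s (s≤s z≤n)))) (s≤s⁻¹ 6≤)))
            (λ { (() , _) })))
        (free a b (vertex (<⇒≤ t+1≤n)) (vertex {n} ≤-refl))
      absurd (suc t′) refl = contradiction
        ( E-sym (vertex-step t+2≤n) , E-sym (vertex-step t+1≤n)
        , Reach-mono (≤-trans (+-mono-≤ 1+n≤s (≤-trans (<⇒≤ (<⇒≤ (<⇒≤ t+2≤n))) (<⇒≤ 1+n≤s))) 2s≤N) (early t′ t′≤n ≤-refl)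
        , vertex-step (<⇒≤ t+1≤n)
        , off-pivot t′≤n t+2≤n (m<n⇒m<1+n (m<n⇒m<1+n ≤-refl)) (<⇒≢ ≤-refl) (λ e → <-irrefl (sym (cong pred e)) (m<n⇒m<1+n ≤-refl)) inner)
        (free a b (vertex (<⇒≤ t+1≤n)) (vertex t′≤n))
        where
        t′≤n : t′ ≤ n
        t′≤n = <⇒≤ (<⇒≤ t+1≤n)
        -- In a cycle of length 4 the vertices a and d would be joined by the closing edge.
        inner : ¬ (t′ ≡ 0 × suc (suc (suc t′)) ≡ n)
        inner (refl , e) = <-irrefl e (≤-trans (s≤s (s≤s (s≤s (s≤s z≤n)))) (s≤s⁻¹ 6≤))

    twoChords : ∃[ i ] ∃[ j ] ∃[ i′ ] ∃[ j′ ] (Chord G n c i j × Chord G n c i′ j′ × (i ≢ i′ ⊎ j ≢ j′))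
    twoChords with any? (λ i → any? λ j → any? λ i′ → any? λ j′ →
      Chord? i j ×-dec Chord? i′ j′ ×-dec (¬? (i ≟ i′) ⊎-dec ¬? (j ≟ j′)))
    ... | yes two = two
    ... | no ¬two with any? (λ i → any? λ j → Chord? i j)
    ... | no none = Pivot.absurd 0 (≤-trans (s≤s (s≤s z≤n)) (s≤s⁻¹ 6≤)) (λ i j ch → contradiction (i , j , ch) none) 0 refl
    -- The pivot is the end of smaller index: the other end lies at least two places later, so b and
    -- a exist without wrapping round. Any other chord starts at the same end, or there would be
    -- two.
    ... | yes (i , j , ch@(i<j , _ , j≢ , _)) =
      Pivot.absurd (toℕ i) (≤-trans (≤∧≢⇒< i<j (λ e → j≢ (sym e))) (toℕ≤pred[n] j))
        (λ i′ j′ ch′ → cong toℕ (decidable-stable (i′ ≟ i) λ i′≢i →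
          ¬two (i , j , i′ , j′ , ch , ch′ , inj₁ (λ e → i′≢i (sym e))))) (toℕ i) refl

  no-obstruction⇒two : ∀ N → s + s ≤ N → (∀ a b c d → ¬ Obstruction N a b c d) → TwoChordalBipartite G
  no-obstruction⇒two N 2s≤N free n c 6≤ cyc = Cycle.twoChords n c 6≤ cyc N 2s≤N free

-- The search program.

bool-ext : ∀ {x y} → (x ≡ true → y ≡ true) → (y ≡ true → x ≡ true) → x ≡ y
bool-ext {true}          f g = sym (f refl)
bool-ext {false} {true}  f g = g refl
bool-ext {false} {false} f g = refl

quotient-unique : ∀ s {q q′ r r′} → r < s → r′ < s → q * s + r ≡ q′ * s + r′ → q ≡ q′ × r ≡ r′
quotient-unique s@(suc _) {q} {q′} {r} {r′} r<s r′<s e = q≡q′ , r≡r′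
  where
  open ≡-Reasoning
  residue : ∀ q {r} → r < s → (q * s + r) % s ≡ r
  residue q {r} r<s = trans (cong (_% s) (+-comm (q * s) r)) (trans ([m+kn]%n≡m%n r q s) (m<n⇒m%n≡m r<s))
  r≡r′ : r ≡ r′
  r≡r′ = trans (sym (residue q r<s)) (trans (cong (_% s) e) (residue q′ r′<s))
  q≡q′ : q ≡ q′
  q≡q′ = *-cancelʳ-≡ q q′ s (+-cancelʳ-≡ r (q * s) (q′ * s) (trans e (cong (q′ * s +_) (sym r≡r′))))

open Language 20

delay : ℕ → (ℕ → Bool) → ℕ → Bool
delay zero    f = f
delay (suc k) f = shifted false (delay k f)

delay-+ : ∀ k f i → delay k f (k + i) ≡ f i
delay-+ zero    f i = refl
delay-+ (suc k) f i = delay-+ k f i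

delay-< : ∀ k f i → i < k → delay k f i ≡ false
delay-< (suc k) f zero    _         = refl
delay-< (suc k) f (suc i) (s≤s i<k) = delay-< k f i i<k

shifted-cong : ∀ {b f g} → (∀ i → f i ≡ g i) → ∀ i → shifted b f i ≡ shifted b g i
shifted-cong f≗g zero    = refl
shifted-cong f≗g (suc i) = f≗g i

Marks : (ℕ → Bool) → ℕ → Set
Marks f m = ∀ i → f i ≡ (m ≡ᵇ i)

delay-marks : ∀ k {f m} → Marks f m → Marks (delay k f) (k + m)
delay-marks zero    marks i       = marks i
delay-marks (suc k) marks zero    = refl
delay-marks (suc k) marks (suc i) = delay-marks k marks i

moveBy : ∀ x l t N σ {k} → spares (shift t false) x ≡ true → not (does (x ≟ t)) ≡ true →
  spares (times x l (shift t false)) l ≡ true → k ≤ N → Prefix N (σ l) k →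
  ∀ i → ⟦ times x l (shift t false) ⟧ N σ t i ≡ delay k (σ t) i
moveBy x l t N σ safe x≢t safe′ k≤N prefix =
  times-rule x l (shift t false) N σ safe safe′ k≤N prefix (λ j τ → ∀ i → τ t i ≡ delay j (σ t) i)
    (λ j τ f h i → trans (cong (λ g → g i) (update-spares τ x t x≢t)) (h i)) (λ i → refl)
    (λ j τ _ _ h i → trans (cong (λ g → g i) (update-self τ t)) (shifted-cong h i))

data Var : Set where
  va vb vu vv : Var

-- `inner` and `outer` serve several loops, as no loop on either is nested in another on the same
-- track. The loops over vertices do nest, so each variable has its own marker.
inA sizeT multT temp found reached inner outer : Track
inA     = # 0
sizeT   = # 1
multT   = # 2
temp    = # 3
found   = # 4
reached = # 5
inner   = # 6
outer   = # 7

rowOf colOf loopOf : Var → Track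
rowOf va = # 8
rowOf vb = # 9
rowOf vu = # 10
rowOf vv = # 11
colOf va = # 12
colOf vb = # 13
colOf vu = # 14
colOf vv = # 15
loopOf va = # 16
loopOf vb = # 17
loopOf vu = # 18
loopOf vv = # 19

-- Track numbers of an unknown variable do not compute, but a check over all four does; frame
-- conditions thus remain provable by `refl`.
everyVar : (f : Var → Bool) → f va ∧ f vb ∧ f vu ∧ f vv ≡ true → ∀ x → f x ≡ true
everyVar f e va = proj₁ (∧-split e)
everyVar f e vb = proj₁ (∧-split (proj₂ (∧-split {f va} e)))
everyVar f e vu = proj₁ (∧-split (proj₂ (∧-split {f vb} (proj₂ (∧-split {f va} e)))))
everyVar f e vv = proj₂ (∧-split {f vu} (proj₂ (∧-split {f vb} (proj₂ (∧-split {f va} e)))))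

resetTemp : Prog
resetTemp = set temp (const false) ⨾ shift temp true

advance : Prog
advance = times inner sizeT (shift temp false)

-- With k the size found so far, k moves by k and one more bring the mark to k (k + 1). Track 16 is
-- `loopOf va`, still free before the search.
oblong : Prog
oblong = resetTemp ⨾ times (# 16) sizeT advance ⨾ advance

-- s is the least k with k (k + 1) no longer below the input length s (s + 1).
findSize : Prog
findSize = loop outer (oblong ⨾ when (on temp) (shift sizeT true))

-- These positions are column 0, from which `forEach` starts.
findMultiples : Prog
findMultiples = resetTemp ⨾ loop outer (set multT (on multT or on temp) ⨾ advance)

-- For x the k-th vertex, rowOf x marks the positions i with i / s = k and colOf x those with i % s = k.
forEach : Var → Prog → Prog
forEach x p = set (rowOf x) (on sizeT) ⨾ set (colOf x) (on multT) ⨾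
  times (loopOf x) sizeT (p ⨾ shift (colOf x) false ⨾ times inner sizeT (shift (rowOf x) false))

-- Row u and column v meet in one cell, so an existential test reads the entry at (u, v).
entryAt : Track → Var → Var → Expr
entryAt t x y = on (rowOf x) & (on (colOf y) & on t)

edge : Var → Var → Expr
edge = entryAt inA

-- A vertex set is read off the diagonal. Adding v may therefore mark its whole row, which meets the
-- diagonal only at v.
visited : Var → Expr
visited x = entryAt reached x x

visit : Prog
visit = when (visited vu) (when (edge vu vv)
  (if-some edge vv vb then skip else set reached (on reached or on (rowOf vv))))

relax : Prog
relax = forEach vu (forEach vv visit)

closure : Prog
closure = set reached (on (rowOf va)) ⨾ loop outer relax

report : Prog
report = if-some edge vv va then skip else set found (const true)

-- Here `vu` and `vv` hold c and d; both are free again once the closure is computed.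
detect : Prog
detect = forEach vu (when (edge vb vu) (forEach vv (when (visited vv) (when (edge vv vu) report))))

search : Prog
search = forEach va (forEach vb (closure ⨾ when (edge va vb) detect))

program : Prog
program = findSize ⨾ findMultiples ⨾ search

program-wellFormed : wellFormed program ≡ true
program-wellFormed = refl

accepts : ℕ → State → Bool
accepts N σ = not (some N (on found) (⟦ program ⟧ N σ))

-- Correctness of the search program.

module Correctness (s′ : ℕ) (G : BipartiteGraph (suc s′)) (N : ℕ) (N≡ : N ≡ suc s′ * suc s′ + suc s′) where

  s : ℕ
  s = suc s′

  open Obstructions G

  pos : Fin s → Fin s → ℕ
  pos u v = toℕ u * s + toℕ v

  s≤N : s ≤ N
  s≤N = ≤-trans (m≤n+m s (s * s)) (≤-reflexive (sym N≡))

  pos<N : ∀ {q} r → q < s → r < s → q * s + r < N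
  pos<N {q} r q<s r<s = subst (q * s + r <_) (sym N≡) (+-mono-≤-< (*-monoˡ-≤ s (<⇒≤ q<s)) r<s)

  advance-marks : ∀ σ {k m} → k ≤ N → Prefix N (σ sizeT) k → Marks (σ temp) m →
                  Marks (⟦ advance ⟧ N σ temp) (k + m)
  advance-marks σ {k} k≤N prefix marks i =
    trans (moveBy inner sizeT temp N σ refl refl refl k≤N prefix i) (delay-marks k marks i)

  resetTemp-marks : ∀ σ → Marks (⟦ resetTemp ⟧ N σ temp) 0
  resetTemp-marks σ zero    = refl
  resetTemp-marks σ (suc i) = refl

  oblong-marks : ∀ τ {k} → k ≤ N → Prefix N (τ sizeT) k → Marks (⟦ oblong ⟧ N τ temp) (k + k * k)
  oblong-marks τ {k} k≤N prefix =
    advance-marks (⟦ times (# 16) sizeT advance ⟧ N σ) k≤N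
      (λ i lt → trans (cong (λ f → f i) (spared (times (# 16) sizeT advance) N σ sizeT refl)) (prefix i lt))
      (times-rule (# 16) sizeT advance N σ refl refl k≤N prefix (λ j τ → Marks (τ temp) (j * k))
        (λ _ _ _ h → h) (resetTemp-marks τ)
        (λ j τ _ agree h → advance-marks τ k≤N (λ i lt → trans (cong (λ f → f i) (agree sizeT refl)) (prefix i lt)) h))
    where
    σ : State
    σ = ⟦ resetTemp ⟧ N τ

  prefix-grow : ∀ {f k} → Prefix N f k → Prefix N (shifted true f) (suc k)
  prefix-grow prefix zero    _  = refl
  prefix-grow prefix (suc i) lt = prefix i (<⇒≤ lt)

  -- After j rounds the size is j ⊓ s: below s the mark at j (j + 1) is still on the tape, and at s
  -- it stands at N, just off it.
  findSize-correct : ∀ σ → (∀ i → σ sizeT i ≡ false) → Prefix N (⟦ findSize ⟧ N σ sizeT) s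
  findSize-correct σ empty = subst (Prefix N (⟦ findSize ⟧ N σ sizeT)) (m≥n⇒m⊓n≡n s≤N)
    (loop-rule outer (oblong ⨾ when (on temp) (shift sizeT true)) N σ refl (λ j τ → Prefix N (τ sizeT) (j ⊓ s)) (λ i _ → empty i) round)
    where
    size-after : ∀ τ → ⟦ oblong ⟧ N τ sizeT ≡ τ sizeT
    size-after τ = spared oblong N τ sizeT refl
    round : ∀ j τ → j < N → Agree findSize τ σ → (∀ i → τ outer i ≡ (j ≡ᵇ i)) → Prefix N (τ sizeT) (j ⊓ s) →
            Prefix N (⟦ oblong ⨾ when (on temp) (shift sizeT true) ⟧ N τ sizeT) (suc j ⊓ s)
    round j τ j<N _ _ prefix with j <? s
    ... | yes j<s = subst₂ (λ ρ k → Prefix N (ρ sizeT) k)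
      (sym (if-true (on temp) (shift sizeT true) skip N (⟦ oblong ⟧ N τ)
        (anyBelow-true (⟦ oblong ⟧ N τ temp) {j + j * j}
          (≤-trans (+-mono-≤ j<s (*-mono-≤ (<⇒≤ j<s) (<⇒≤ j<s))) (≤-reflexive (trans (+-comm s (s * s)) (sym N≡))))
          (trans (oblong-marks τ (<⇒≤ j<N) prefix′ (j + j * j)) (≡ᵇ-refl (j + j * j))))))
      (sym (m≤n⇒m⊓n≡m j<s))
      (subst (λ f → Prefix N (shifted true f) (suc j)) (sym (size-after τ)) (prefix-grow prefix′))
      where
      prefix′ : Prefix N (τ sizeT) j
      prefix′ = subst (Prefix N (τ sizeT)) (m≤n⇒m⊓n≡m (<⇒≤ j<s)) prefix
    ... | no j≮s = subst₂ (λ ρ k → Prefix N (ρ sizeT) k)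
      (sym (if-false (on temp) (shift sizeT true) skip N (⟦ oblong ⟧ N τ)
        (anyBelow-false N (⟦ oblong ⟧ N τ temp)
          (λ i i<N e → contradiction (≡ᵇ-true⇒≡ (s + s * s) i (trans (sym (oblong-marks τ s≤N prefix′ i)) e))
                                      (λ eq → <⇒≢ i<N (trans (sym eq) (trans (+-comm s (s * s)) (sym N≡))))))))
      (sym (m≥n⇒m⊓n≡n (m≤n⇒m≤1+n (≮⇒≥ j≮s))))
      (subst (λ f → Prefix N f s) (sym (size-after τ)) prefix′)
      where
      prefix′ : Prefix N (τ sizeT) s
      prefix′ = subst (Prefix N (τ sizeT)) (m≥n⇒m⊓n≡n (≮⇒≥ j≮s)) prefix

  Multiples : (ℕ → Bool) → Set
  Multiples f = ∀ q r → r < s → q * s + r < N → f (q * s + r) ≡ (r ≡ᵇ 0)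

  findMultiples-correct : ∀ σ → (∀ i → σ multT i ≡ false) → Prefix N (σ sizeT) s →
                          Multiples (⟦ findMultiples ⟧ N σ multT)
  findMultiples-correct σ empty prefix q r r<s lt =
    trans (proj₂ end q r r<s) (cong (_∧ (r ≡ᵇ 0)) (exceeds q<N))
    where
    q<N : q < N
    q<N = ≤-trans (s≤s (≤-trans (m≤m*n q s) (m≤m+n (q * s) r))) lt
    Inv : ℕ → State → Set
    Inv j τ = Marks (τ temp) (j * s) × (∀ q r → r < s → τ multT (q * s + r) ≡ (q <ᵇ j) ∧ (r ≡ᵇ 0))
    extend : ∀ j q r → r < s → (q <ᵇ j) ∧ (r ≡ᵇ 0) ∨ (j * s ≡ᵇ q * s + r) ≡ (q <ᵇ suc j) ∧ (r ≡ᵇ 0)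
    extend j q r r<s = bool-ext to from
      where
      to : (q <ᵇ j) ∧ (r ≡ᵇ 0) ∨ (j * s ≡ᵇ q * s + r) ≡ true → (q <ᵇ suc j) ∧ (r ≡ᵇ 0) ≡ true
      to e with (q <ᵇ j) ∧ (r ≡ᵇ 0) in e′
      ... | true  = let e₁ , e₂ = ∧-split e′ in cong₂ _∧_ (exceeds (m<n⇒m<1+n (<ᵇ-true⇒< q j e₁))) e₂
      ... | false with quotient-unique s {j} {q} {0} {r} (s≤s z≤n) r<s (trans (+-identityʳ (j * s)) (≡ᵇ-true⇒≡ (j * s) (q * s + r) e))
      ... | refl , refl = cong (_∧ true) (exceeds (n<1+n j))
      from : (q <ᵇ suc j) ∧ (r ≡ᵇ 0) ≡ true → (q <ᵇ j) ∧ (r ≡ᵇ 0) ∨ (j * s ≡ᵇ q * s + r) ≡ true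
      from e with ∧-split e
      ... | e₁ , e₂ with m≤n⇒m<n∨m≡n (<ᵇ-true⇒< q (suc j) e₁) | ≡ᵇ-true⇒≡ r 0 e₂
      ... | inj₁ (s≤s q<j) | refl rewrite exceeds q<j = refl
      ... | inj₂ refl      | refl rewrite +-identityʳ (q * s) | ≡ᵇ-refl (q * s) = ∨-zeroʳ _
    end : Inv N (⟦ findMultiples ⟧ N σ)
    end = loop-rule outer (set multT (on multT or on temp) ⨾ advance) N (⟦ resetTemp ⟧ N σ) refl Inv
      (resetTemp-marks σ , λ q r _ → empty (q * s + r))
      (λ j τ _ agree _ (marks , mult) →
        advance-marks (⟦ set multT (on multT or on temp) ⟧ N τ) s≤N
          (λ i lt → trans (cong (λ f → f i) (agree sizeT refl)) (prefix i lt)) marks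
        , λ q r r<s → trans (cong (λ f → f (q * s + r)) (spared advance N (⟦ set multT (on multT or on temp) ⟧ N τ) multT refl))
                        (trans (cong₂ _∨_ (mult q r r<s) (marks (q * s + r))) (extend j q r r<s)))

  record Ready (τ : State) : Set where
    field
      prefix : Prefix N (τ sizeT) s
      mult   : Multiples (τ multT)
      matrix : ∀ u v → τ inA (pos u v) ≡ E u v

  Ready-cong : ∀ {τ σ} → τ sizeT ≡ σ sizeT → τ multT ≡ σ multT → τ inA ≡ σ inA → Ready σ → Ready τ
  Ready-cong e₁ e₂ e₃ ready = record
    { prefix = subst (λ f → Prefix N f s) (sym e₁) (Ready.prefix ready)
    ; mult   = subst Multiples (sym e₂) (Ready.mult ready)
    ; matrix = λ u v → trans (cong (λ f → f (pos u v)) e₃) (Ready.matrix ready u v) }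

  -- Positions are split as q * s + r; the last row, q = s, carries the side bits.
  Holds : State → Var → ℕ → Set
  Holds τ x k = ∀ q r → r < s → q * s + r < N →
    τ (rowOf x) (q * s + r) ≡ (q ≡ᵇ k) × τ (colOf x) (q * s + r) ≡ (r ≡ᵇ k)

  Holds-cong : ∀ τ σ x {k} → τ (rowOf x) ≡ σ (rowOf x) → τ (colOf x) ≡ σ (colOf x) → Holds σ x k → Holds τ x k
  Holds-cong τ σ x e₁ e₂ holds q r r<s lt =
    trans (cong (λ f → f (q * s + r)) e₁) (proj₁ (holds q r r<s lt)) ,
    trans (cong (λ f → f (q * s + r)) e₂) (proj₂ (holds q r r<s lt))

  entryAt-correct : ∀ t x y τ (u v : Fin s) → Holds τ x (toℕ u) → Holds τ y (toℕ v) →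
                    some N (entryAt t x y) τ ≡ τ t (pos u v)
  entryAt-correct t x y τ u v hx hy = bool-ext to from
    where
    to : some N (entryAt t x y) τ ≡ true → τ t (pos u v) ≡ true
    to e with anyBelow-witness N _ e
    ... | i , i<N , ei with ∧-split ei
    ... | er , ect with ∧-split ect
    ... | ec , et = subst (λ i → τ t i ≡ true) (trans split (cong₂ (λ q r → q * s + r) q≡u r≡v)) et
      where
      split : i ≡ (i / s) * s + i % s
      split = trans (m≡m%n+[m/n]*n i s) (+-comm (i % s) ((i / s) * s))
      lt : (i / s) * s + i % s < N
      lt = subst (_< N) split i<N
      q≡u : i / s ≡ toℕ u
      q≡u = ≡ᵇ-true⇒≡ _ _ (trans (sym (proj₁ (hx (i / s) (i % s) (m%n<n i s) lt))) (subst (λ i → τ (rowOf x) i ≡ true) split er))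
      r≡v : i % s ≡ toℕ v
      r≡v = ≡ᵇ-true⇒≡ _ _ (trans (sym (proj₂ (hy (i / s) (i % s) (m%n<n i s) lt))) (subst (λ i → τ (colOf y) i ≡ true) split ec))
    from : τ t (pos u v) ≡ true → some N (entryAt t x y) τ ≡ true
    from e = anyBelow-true _ lt (cong₂ _∧_
      (trans (proj₁ (hx (toℕ u) (toℕ v) (toℕ<n v) lt)) (≡ᵇ-refl (toℕ u)))
      (cong₂ _∧_ (trans (proj₂ (hy (toℕ u) (toℕ v) (toℕ<n v) lt)) (≡ᵇ-refl (toℕ v))) e))
      where
      lt : pos u v < N
      lt = pos<N (toℕ v) (toℕ<n u) (toℕ<n v)

  edge-correct : ∀ x y {τ u v} → Ready τ → Holds τ x (toℕ u) → Holds τ y (toℕ v) → some N (edge x y) τ ≡ E u v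
  edge-correct x y {τ} {u} {v} ready hx hy =
    trans (entryAt-correct inA x y τ u v hx hy) (Ready.matrix ready u v)

  rows-start : ∀ q r → r < s → (q * s + r <ᵇ s) ≡ (q ≡ᵇ 0)
  rows-start zero    r r<s = exceeds r<s
  rows-start (suc q) r r<s = ≢true⇒false λ e →
    contradiction (<ᵇ-true⇒< _ s e) (≤⇒≯ (≤-trans (m≤m+n s (q * s)) (m≤m+n (s + q * s) r)))

  rows-step : ∀ f j → (∀ q r → r < s → q * s + r < N → f (q * s + r) ≡ (q ≡ᵇ j)) →
              ∀ q r → r < s → q * s + r < N → delay s f (q * s + r) ≡ (q ≡ᵇ suc j)
  rows-step f j h zero    r r<s lt = delay-< s f r r<s
  rows-step f j h (suc q) r r<s lt =
    trans (cong (delay s f) (+-assoc s (q * s) r))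
      (trans (delay-+ s f (q * s + r)) (h q r r<s (≤-<-trans (+-monoˡ-≤ r (m≤n+m (q * s) s)) lt)))

  -- A shift wraps the last column into the next row; column j is not the last, so nothing marked
  -- wraps.
  columns-step : ∀ f j → suc j < s → (∀ q r → r < s → q * s + r < N → f (q * s + r) ≡ (r ≡ᵇ j)) →
                 ∀ q r → r < s → q * s + r < N → shifted false f (q * s + r) ≡ (r ≡ᵇ suc j)
  columns-step f j _ h q (suc r) r<s lt rewrite +-suc (q * s) r = h q r (<⇒≤ r<s) (<⇒≤ lt)
  columns-step f j _ h zero    zero _ lt = refl
  columns-step f j (s≤s j<s′) h (suc q) zero _ lt =
    trans (cong f wrap) (trans (h q s′ (n<1+n s′) (<⇒≤ (subst (λ i → suc i < N) wrap lt)))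
          (≢true⇒false λ e → contradiction (sym (≡ᵇ-true⇒≡ s′ j e)) (<⇒≢ j<s′)))
    where
    wrap : s′ + q * s + 0 ≡ q * s + s′
    wrap = trans (+-identityʳ (s′ + q * s)) (+-comm s′ (q * s))

  module _ (x : Var) (p : Prog) (safeS : spares p sizeT ≡ true) (safeR : spares p (rowOf x) ≡ true)
           (safeC : spares p (colOf x) ≡ true) (safeL : spares p (loopOf x) ≡ true) where

    -- Results accumulate only in `reached` and `found`, so `J` sees nothing else and moving marks
    -- cannot disturb it. After the last round no vertex is left, which is why `Holds` is carried
    -- only while j < s.
    forEach-rule : ∀ σ → Ready σ → (J : ℕ → (ℕ → Bool) → (ℕ → Bool) → Set) → J 0 (σ reached) (σ found) →
      (∀ (k : Fin s) τ → Agree (forEach x p) τ σ → Holds τ x (toℕ k) → J (toℕ k) (τ reached) (τ found) →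
         J (suc (toℕ k)) (⟦ p ⟧ N τ reached) (⟦ p ⟧ N τ found)) →
      J s (⟦ forEach x p ⟧ N σ reached) (⟦ forEach x p ⟧ N σ found)
    forEach-rule σ ready J base ind =
      proj₂ (times-rule (loopOf x) sizeT round N σ₁ safe-loop safe-size s≤N prefix₁
        (λ j τ → (j < s → Holds τ x j) × J j (τ reached) (τ found)) insensitive (holds₁ , base₁) next)
      where
      nextRow round : Prog
      nextRow = times inner sizeT (shift (rowOf x) false)
      round = p ⨾ shift (colOf x) false ⨾ nextRow

      σ₁ : State
      σ₁ = ⟦ set (rowOf x) (on sizeT) ⨾ set (colOf x) (on multT) ⟧ N σ

      safe-loop : spares round (loopOf x) ≡ true
      safe-loop = cong₂ _∧_ safeL (everyVar (λ x → spares (shift (colOf x) false ⨾ times inner sizeT (shift (rowOf x) false)) (loopOf x)) refl x)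

      safe-size : spares (times (loopOf x) sizeT round) sizeT ≡ true
      safe-size = cong₂ _∧_ (everyVar (λ x → not (does (loopOf x ≟ sizeT))) refl x)
        (cong (_∧ true) (cong₂ _∧_ safeS
          (everyVar (λ x → spares (shift (colOf x) false ⨾ times inner sizeT (shift (rowOf x) false)) sizeT) refl x)))

      unset : ∀ t → not (does (rowOf x ≟ t)) ≡ true → not (does (colOf x ≟ t)) ≡ true → σ₁ t ≡ σ t
      unset t e e′ = trans (update-spares (⟦ set (rowOf x) (on sizeT) ⟧ N σ) (colOf x) t e′) (update-spares σ (rowOf x) t e)

      prefix₁ : Prefix N (σ₁ sizeT) s
      prefix₁ = subst (λ f → Prefix N f s) (sym (unset sizeT
        (everyVar (λ x → not (does (rowOf x ≟ sizeT))) refl x) (everyVar (λ x → not (does (colOf x ≟ sizeT))) refl x)))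
        (Ready.prefix ready)

      holds₁ : 0 < s → Holds σ₁ x 0
      holds₁ _ q r r<s lt =
        trans (cong (λ f → f (q * s + r)) (trans (update-spares (⟦ set (rowOf x) (on sizeT) ⟧ N σ) (colOf x) (rowOf x)
                (everyVar (λ x → not (does (colOf x ≟ rowOf x))) refl x)) (update-self σ (rowOf x))))
              (trans (Ready.prefix ready _ lt) (rows-start q r r<s)) ,
        trans (cong (λ f → f (q * s + r)) (trans (update-self (⟦ set (rowOf x) (on sizeT) ⟧ N σ) (colOf x))
                (update-spares σ (rowOf x) multT (everyVar (λ x → not (does (rowOf x ≟ multT))) refl x))))
              (Ready.mult ready q r r<s lt)

      base₁ : J 0 (σ₁ reached) (σ₁ found)
      base₁ = subst₂ (J 0)
        (sym (unset reached (everyVar (λ x → not (does (rowOf x ≟ reached))) refl x) (everyVar (λ x → not (does (colOf x ≟ reached))) refl x)))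
        (sym (unset found (everyVar (λ x → not (does (rowOf x ≟ found))) refl x) (everyVar (λ x → not (does (colOf x ≟ found))) refl x)))
        base

      insensitive : ∀ j τ f → (j < s → Holds τ x j) × J j (τ reached) (τ found) →
        let τ′ = update τ (loopOf x) f in (j < s → Holds τ′ x j) × J j (τ′ reached) (τ′ found)
      insensitive j τ f (h , Jj) =
        (λ j<s → Holds-cong (update τ (loopOf x) f) τ x
          (update-spares τ (loopOf x) (rowOf x) (everyVar (λ x → not (does (loopOf x ≟ rowOf x))) refl x))
          (update-spares τ (loopOf x) (colOf x) (everyVar (λ x → not (does (loopOf x ≟ colOf x))) refl x)) (h j<s)) ,
        subst₂ (J j)
          (sym (update-spares τ (loopOf x) reached (everyVar (λ x → not (does (loopOf x ≟ reached))) refl x)))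
          (sym (update-spares τ (loopOf x) found (everyVar (λ x → not (does (loopOf x ≟ found))) refl x))) Jj

      next : ∀ j τ → j < s → Agree (times (loopOf x) sizeT round) τ σ₁ → (j < s → Holds τ x j) × J j (τ reached) (τ found) →
        let τ′ = ⟦ round ⟧ N τ in (suc j < s → Holds τ′ x (suc j)) × J (suc j) (τ′ reached) (τ′ found)
      next j τ j<s agree (h , Jj) = holds′ ,
        subst₂ (J (suc j))
          (sym (spared (shift (colOf x) false ⨾ nextRow) N τ₁ reached
            (everyVar (λ x → spares (shift (colOf x) false ⨾ times inner sizeT (shift (rowOf x) false)) reached) refl x)))
          (sym (spared (shift (colOf x) false ⨾ nextRow) N τ₁ found
            (everyVar (λ x → spares (shift (colOf x) false ⨾ times inner sizeT (shift (rowOf x) false)) found) refl x)))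
          (subst (λ j → J (suc j) (τ₁ reached) (τ₁ found)) (toℕ-fromℕ< j<s)
            (ind (fromℕ< j<s) τ agree′ (subst (Holds τ x) (sym (toℕ-fromℕ< j<s)) (h j<s))
              (subst (λ j → J j (τ reached) (τ found)) (sym (toℕ-fromℕ< j<s)) Jj)))
        where
        τ₁ τ₂ : State
        τ₁ = ⟦ p ⟧ N τ
        τ₂ = ⟦ shift (colOf x) false ⟧ N τ₁
        agree′ : Agree (forEach x p) τ σ
        agree′ t e =
          let e₁ , e′ = ∧-split e
              e₂ , e₃ = ∧-split {not (does (colOf x ≟ t))} e′
          in trans (agree t e₃) (unset t e₁ e₂)
        prefix₂ : Prefix N (τ₂ sizeT) s
        prefix₂ = subst (λ f → Prefix N f s) (sym (trans
          (update-spares τ₁ (colOf x) sizeT (everyVar (λ x → not (does (colOf x ≟ sizeT))) refl x))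
          (trans (spared p N τ sizeT safeS) (agree sizeT safe-size)))) prefix₁
        col : ∀ i → ⟦ round ⟧ N τ (colOf x) i ≡ shifted false (τ (colOf x)) i
        col i = trans
          (cong (λ f → f i) (trans (spared nextRow N τ₂ (colOf x) (everyVar (λ x → spares (times inner sizeT (shift (rowOf x) false)) (colOf x)) refl x))
            (update-self τ₁ (colOf x))))
          (cong (λ f → shifted false f i) (spared p N τ (colOf x) safeC))
        row : ∀ i → ⟦ round ⟧ N τ (rowOf x) i ≡ delay s (τ (rowOf x)) i
        row i = trans
          (moveBy inner sizeT (rowOf x) N τ₂
            (everyVar (λ x → spares (shift (rowOf x) false) inner) refl x)
            (everyVar (λ x → not (does (inner ≟ rowOf x))) refl x)
            (everyVar (λ x → spares (times inner sizeT (shift (rowOf x) false)) sizeT) refl x) s≤N prefix₂ i)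
          (cong (λ f → delay s f i) (trans
            (update-spares τ₁ (colOf x) (rowOf x) (everyVar (λ x → not (does (colOf x ≟ rowOf x))) refl x))
            (spared p N τ (rowOf x) safeR)))
        holds′ : suc j < s → Holds (⟦ round ⟧ N τ) x (suc j)
        holds′ lt′ q r r<s lt =
          trans (row (q * s + r)) (rows-step _ j (λ q r r<s lt → proj₁ (h j<s q r r<s lt)) q r r<s lt) ,
          trans (col (q * s + r)) (columns-step _ j lt′ (λ q r r<s lt → proj₂ (h j<s q r r<s lt)) q r r<s lt)

  Ready-agree : ∀ p {ρ τ} → Agree p ρ τ → spares p sizeT ∧ spares p multT ∧ spares p inA ≡ true → Ready τ → Ready ρ
  Ready-agree p agree e = let e₁ , e′ = ∧-split e ; e₂ , e₃ = ∧-split {spares p multT} e′ in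
    Ready-cong (agree sizeT e₁) (agree multT e₂) (agree inA e₃)

  Holds-agree : ∀ p {ρ τ} x {k} → Agree p ρ τ → spares p (rowOf x) ∧ spares p (colOf x) ≡ true → Holds τ x k → Holds ρ x k
  Holds-agree p {ρ} {τ} x agree e = let e₁ , e₂ = ∧-split e in
    Holds-cong ρ τ x (agree (rowOf x) e₁) (agree (colOf x) e₂)

  extend : ∀ (P : Fin s → Set) (k : Fin s) → (∀ v → toℕ v < toℕ k → P v) → P k → ∀ v → toℕ v < suc (toℕ k) → P v
  extend P k below here v (s≤s v≤k) with m≤n⇒m<n∨m≡n v≤k
  ... | inj₁ v<k = below v v<k
  ... | inj₂ v≡k = subst P (toℕ-injective (sym v≡k)) here

  _∋_ : (ℕ → Bool) → Fin s → Set
  W ∋ v = W (pos v v) ≡ true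

  module Closure (a b : Fin s) where

    -- The number of steps is existential because one pass over all pairs may already use marks that
    -- it has just set.
    Sound : (ℕ → Bool) → Set
    Sound W = ∀ v → W ∋ v → ∃[ m ] Reach a b m v

    Step : Fin s → Fin s → (ℕ → Bool) → (ℕ → Bool) → Set
    Step u v W W′ = W ∋ u → E u v ≡ true → E v b ≡ false → W′ ∋ v

    Growth : (ℕ → Bool) → (ℕ → Bool) → Set
    Growth W W′ = (Sound W → Sound W′) × (∀ v → W ∋ v → W′ ∋ v)

    visit-correct : ∀ {u v} τ → Ready τ → Holds τ vb (toℕ b) → Holds τ vu (toℕ u) → Holds τ vv (toℕ v) →
      let W′ = ⟦ visit ⟧ N τ reached in Growth (τ reached) W′ × Step u v (τ reached) W′
    visit-correct {u} {v} τ ready hb hu hv =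
      if-elim Goal (visited vu) (when (edge vu vv) try) skip N τ
        (λ seen → if-elim Goal (edge vu vv) try skip N τ
          (λ uv → if-elim Goal (edge vv vb) skip mark N τ
            (λ vb′ → idle λ _ _ ¬vb → true≢false (trans (sym vb-test) vb′) ¬vb)
            (λ ¬vb → marked (trans (sym u-test) seen) (trans (sym uv-test) uv) (trans (sym vb-test) ¬vb)))
          (λ ¬uv → idle λ _ uv _ → true≢false uv (trans (sym uv-test) ¬uv)))
        (λ ¬seen → idle λ seen _ _ → true≢false seen (trans (sym u-test) ¬seen))
      where
      mark try : Prog
      mark = set reached (on reached or on (rowOf vv))
      try = if-some edge vv vb then skip else mark
      Goal : State → Set
      Goal τ′ = Growth (τ reached) (τ′ reached) × Step u v (τ reached) (τ′ reached)
      u-test : some N (visited vu) τ ≡ τ reached (pos u u)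
      u-test = entryAt-correct reached vu vu τ u u hu hu
      uv-test : some N (edge vu vv) τ ≡ E u v
      uv-test = edge-correct vu vv ready hu hv
      vb-test : some N (edge vv vb) τ ≡ E v b
      vb-test = edge-correct vv vb ready hv hb
      idle : (τ reached ∋ u → E u v ≡ true → E v b ≡ false → ⊥) → Goal τ
      idle ¬step = ((λ x → x) , λ _ x → x) , λ x y z → ⊥-elim (¬step x y z)
      row-v : ∀ w → τ (rowOf vv) (pos w w) ≡ (toℕ w ≡ᵇ toℕ v)
      row-v w = proj₁ (hv (toℕ w) (toℕ w) (toℕ<n w) (pos<N (toℕ w) (toℕ<n w) (toℕ<n w)))
      marked : τ reached ∋ u → E u v ≡ true → E v b ≡ false → Goal (⟦ mark ⟧ N τ)
      marked seen uv ¬vb = (sound , λ w e → cong (_∨ τ (rowOf vv) (pos w w)) e) ,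
        λ _ _ _ → trans (cong (τ reached (pos v v) ∨_) (trans (row-v v) (≡ᵇ-refl (toℕ v)))) (∨-zeroʳ _)
        where
        sound : Sound (τ reached) → Sound (⟦ mark ⟧ N τ reached)
        sound ok w e with τ reached (pos w w) in old
        ... | true  = ok w old
        ... | false with toℕ-injective {i = w} {v} (≡ᵇ-true⇒≡ _ _ (trans (sym (row-v w)) e))
        ... | refl = let m , r = ok u seen in suc m , inj₂ (¬vb , u , r , uv)

    scan-correct : ∀ {u} τ → Ready τ → Holds τ vb (toℕ b) → Holds τ vu (toℕ u) →
      let W′ = ⟦ forEach vv visit ⟧ N τ reached in Growth (τ reached) W′ × (∀ v → Step u v (τ reached) W′)
    scan-correct {u} τ ready hb hu =
      let growth , steps = forEach-rule vv visit refl refl refl refl τ ready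
            (λ j W _ → Growth (τ reached) W × (∀ v → toℕ v < j → Step u v (τ reached) W))
            (((λ x → x) , λ _ x → x) , λ _ ())
            (λ k ρ agree hv ((sound , grow) , steps) →
              let ready′ = Ready-agree (forEach vv visit) agree refl ready
                  hb′ = Holds-agree (forEach vv visit) vb agree refl hb
                  hu′ = Holds-agree (forEach vv visit) vu agree refl hu
                  (sound′ , grow′) , step = visit-correct ρ ready′ hb′ hu′ hv
              in ((λ x → sound′ (sound x)) , λ v x → grow′ v (grow v x)) ,
                 extend (λ v → Step u v (τ reached) (⟦ visit ⟧ N ρ reached)) k
                   (λ v lt seen uv ¬vb → grow′ v (steps v lt seen uv ¬vb))
                   (λ seen → step (grow u seen)))
      in growth , λ v → steps v (toℕ<n v)

    relax-correct : ∀ τ → Ready τ → Holds τ vb (toℕ b) →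
      let W′ = ⟦ relax ⟧ N τ reached in Growth (τ reached) W′ × (∀ u v → Step u v (τ reached) W′)
    relax-correct τ ready hb =
      let growth , steps = forEach-rule vu (forEach vv visit) refl refl refl refl τ ready
            (λ j W _ → Growth (τ reached) W × (∀ u → toℕ u < j → ∀ v → Step u v (τ reached) W))
            (((λ x → x) , λ _ x → x) , λ _ ())
            (λ k ρ agree hu ((sound , grow) , steps) →
              let ready′ = Ready-agree relax agree refl ready
                  hb′ = Holds-agree relax vb agree refl hb
                  (sound′ , grow′) , step = scan-correct ρ ready′ hb′ hu
              in ((λ x → sound′ (sound x)) , λ v x → grow′ v (grow v x)) ,
                 extend (λ u → ∀ v → Step u v (τ reached) (⟦ forEach vv visit ⟧ N ρ reached)) k
                   (λ u lt v seen uv ¬vb → grow′ v (steps u lt v seen uv ¬vb))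
                   (λ v seen → step v (grow k seen)))
      in growth , λ u → steps u (toℕ<n u)

    Reached : (ℕ → Bool) → Set
    Reached W = Sound W × (∀ v → Reach a b N v → W ∋ v)

    closure-correct : ∀ τ → Ready τ → Holds τ va (toℕ a) → Holds τ vb (toℕ b) → Reached (⟦ closure ⟧ N τ reached)
    closure-correct τ ready ha hb =
      loop-rule outer relax N (⟦ set reached (on (rowOf va)) ⟧ N τ) refl
        (λ j ρ → Sound (ρ reached) × (∀ v → Reach a b j v → ρ reached ∋ v))
        ((λ v e → 0 , toℕ-injective (≡ᵇ-true⇒≡ _ _ (trans (sym (row-a v)) e))) ,
         λ { v refl → trans (row-a a) (≡ᵇ-refl (toℕ a)) })
        (λ j ρ _ agree _ (sound , complete) →
          let ready′ = Ready-agree (loop outer relax) agree refl (Ready-cong refl refl refl ready)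
              hb′ = Holds-agree (loop outer relax) vb agree refl hb
              (sound′ , grow) , steps = relax-correct ρ ready′ hb′
          in sound′ sound , λ { v (inj₁ r) → grow v (complete v r)
                              ; v (inj₂ (¬vb , u , r , uv)) → steps u v (complete u r) uv ¬vb })
      where
      row-a : ∀ w → τ (rowOf va) (pos w w) ≡ (toℕ w ≡ᵇ toℕ a)
      row-a w = proj₁ (ha (toℕ w) (toℕ w) (toℕ<n w) (pos<N (toℕ w) (toℕ<n w) (toℕ<n w)))

  -- The walk length is left open, matching `Sound`; the converse direction works with length N.
  Found : Set
  Found = ∃[ m ] ∃[ a ] ∃[ b ] ∃[ c ] ∃[ d ] Obstruction m a b c d

  Honest : (ℕ → Bool) → Set
  Honest B = ∀ i → B i ≡ true → Found

  -- No false alarm is raised, no alarm is erased, and `P` raises one. Alarms fill the whole track,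
  -- so position 0 can stand for it.
  Detects : Set → Prog → State → Set
  Detects P p τ = let B = τ found ; B′ = ⟦ p ⟧ N τ found in
    (Honest B → Honest B′) × (B 0 ≡ true → B′ 0 ≡ true) × (P → B′ 0 ≡ true)

  Detects-map : ∀ {P Q p τ} → (Q → P) → Detects P p τ → Detects Q p τ
  Detects-map f (honest , keep , hit) = honest , keep , λ q → hit (f q)

  Detects-if : ∀ {e p q τ β P Q} → some N e τ ≡ β → (β ≡ true → Detects P p τ) → (β ≡ false → Detects Q q τ) →
    Detects ((β ≡ true × P) ⊎ (β ≡ false × Q)) (if-some e then p else q) τ
  Detects-if {e} {p} {q} {τ} {β} {P} {Q} test dp dq =
    if-elim Goal e p q N τ
      (λ t → let honest , keep , hit = dp (trans (sym test) t) in honest , keep ,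
        λ { (inj₁ (_ , x)) → hit x ; (inj₂ (f , _)) → true≢false (trans (sym test) t) f })
      (λ f → let honest , keep , hit = dq (trans (sym test) f) in honest , keep ,
        λ { (inj₁ (t , _)) → true≢false t (trans (sym test) f) ; (inj₂ (_ , x)) → hit x })
    where
    Goal : State → Set
    Goal τ′ = (Honest (τ found) → Honest (τ′ found)) × (τ found 0 ≡ true → τ′ found 0 ≡ true) ×
              ((β ≡ true × P) ⊎ (β ≡ false × Q) → τ′ found 0 ≡ true)

  Detects-skip : ∀ τ → Detects ⊥ skip τ
  Detects-skip τ = (λ x → x) , (λ x → x) , ⊥-elim

  Detects-when : ∀ {e p τ β P} → some N e τ ≡ β → (β ≡ true → Detects P p τ) → Detects (β ≡ true × P) (when e p) τ
  Detects-when {e} {p} {τ} test dp = Detects-map {p = when e p} {τ = τ} inj₁ (Detects-if {e} {p} {skip} {τ} test dp (λ _ → Detects-skip τ))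

  forEach-detects : ∀ x p → spares p sizeT ≡ true → spares p (rowOf x) ≡ true → spares p (colOf x) ≡ true →
    spares p (loopOf x) ≡ true → ∀ τ {P : Fin s → Set} → Ready τ →
    (∀ k ρ → Agree (forEach x p) ρ τ → Holds ρ x (toℕ k) → Detects (P k) p ρ) → Detects (∃[ k ] P k) (forEach x p) τ
  forEach-detects x p e₁ e₂ e₃ e₄ τ {P} ready each =
    let honest , keep , hit = forEach-rule x p e₁ e₂ e₃ e₄ τ ready
          (λ j _ B → (Honest (τ found) → Honest B) × (τ found 0 ≡ true → B 0 ≡ true) × (∀ k → toℕ k < j → P k → B 0 ≡ true))
          ((λ x → x) , (λ x → x) , λ _ ())
          (λ k ρ agree hx (honest , keep , hit) →
            let honest′ , keep′ , hit′ = each k ρ agree hx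
            in (λ x → honest′ (honest x)) , (λ x → keep′ (keep x)) ,
               extend (λ k → P k → ⟦ p ⟧ N ρ found 0 ≡ true) k (λ v lt Pv → keep′ (hit v lt Pv)) hit′)
    in honest , keep , λ (k , Pk) → hit k (toℕ<n k) Pk

  report-detects : ∀ {a b c d m} τ → Ready τ → Holds τ va (toℕ a) → Holds τ vv (toℕ d) →
    E a b ≡ true → E b c ≡ true → Reach a b m d → E d c ≡ true → Detects (E d a ≡ false) report τ
  report-detects {a} {b} {c} {d} {m} τ ready ha hd ab bc r dc =
    Detects-map {p = report} {τ = τ} (λ f → inj₂ (f , f))
      (Detects-if {edge vv va} {skip} {set found (const true)} {τ} (edge-correct vv va ready hd ha) (λ _ → Detects-skip τ)
        (λ da → (λ _ _ _ → m , a , b , c , d , ab , bc , r , dc , da) , (λ _ → refl) , λ _ → refl))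

  detect-detects : ∀ {a b} τ → Ready τ → Holds τ va (toℕ a) → Holds τ vb (toℕ b) → Closure.Reached a b (τ reached) →
    E a b ≡ true → Detects (∃[ c ] ∃[ d ] Obstruction N a b c d) detect τ
  detect-detects {a} {b} τ ready ha hb (sound , complete) ab =
    Detects-map {p = detect} {τ = τ}
      (λ { (c , d , _ , bc , r , dc , da) → c , bc , d , complete d r , dc , da })
      (forEach-detects vu (when (edge vb vu) examineAll) refl refl refl refl τ ready
        λ c ρ agree hc →
          let ready′ = Ready-agree detect agree refl ready
              ha′ = Holds-agree detect va agree refl ha
              hb′ = Holds-agree detect vb agree refl hb
          in Detects-when {edge vb vu} {examineAll} {ρ} (edge-correct vb vu ready′ hb′ hc) λ bc →
            forEach-detects vv examine refl refl refl refl ρ ready′ λ d υ agree′ hd →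
              let ready″ = Ready-agree examineAll agree′ refl ready′
                  ha″ = Holds-agree examineAll va agree′ refl ha′
                  hc″ = Holds-agree examineAll vu agree′ refl hc
                  unchanged : υ reached ≡ τ reached
                  unchanged = trans (agree′ reached refl) (agree reached refl)
              in Detects-when {visited vv} {when (edge vv vu) report} {υ}
                   (trans (entryAt-correct reached vv vv υ d d hd hd) (cong (λ W → W (pos d d)) unchanged)) λ seen →
                 Detects-when {edge vv vu} {report} {υ} (edge-correct vv vu ready″ hd hc″) λ dc →
                 report-detects υ ready″ ha″ hd ab bc (proj₂ (sound d seen)) dc)
    where
    examine examineAll : Prog
    examine = when (visited vv) (when (edge vv vu) report)
    examineAll = forEach vv examine

  search-detects : ∀ τ → Ready τ → Detects (∃[ a ] ∃[ b ] ∃[ c ] ∃[ d ] Obstruction N a b c d) search τ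
  search-detects τ ready =
    forEach-detects va (forEach vb core) refl refl refl refl τ ready λ a ρ agree ha →
      let ready′ = Ready-agree search agree refl ready
      in forEach-detects vb core refl refl refl refl ρ ready′ λ b υ agree′ hb →
        let ready″ = Ready-agree (forEach vb core) agree′ refl ready′
            ha″ = Holds-agree (forEach vb core) va agree′ refl ha
            agreeC : Agree closure (⟦ closure ⟧ N υ) υ
            agreeC = λ t → spared closure N υ t
            readyC = Ready-agree closure agreeC refl ready″
            haC = Holds-agree closure va agreeC refl ha″
            hbC = Holds-agree closure vb agreeC refl hb
            honest , keep , hit = Detects-when {edge va vb} {detect} {⟦ closure ⟧ N υ} (edge-correct va vb readyC haC hbC)
              (detect-detects (⟦ closure ⟧ N υ) readyC haC hbC (Closure.closure-correct a b υ ready″ ha″ hb))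
            same : ⟦ closure ⟧ N υ found ≡ υ found
            same = agreeC found refl
        in (λ h → honest (subst Honest (sym same) h)) , (λ e → keep (trans (cong (λ B → B 0) same) e)) ,
           λ { (c , d , ob) → hit (proj₁ ob , c , d , ob) }
    where
    core : Prog
    core = closure ⨾ when (edge va vb) detect

  program-correct : ∀ σ → (∀ u v → σ inA (pos u v) ≡ E u v) → (∀ i → σ sizeT i ≡ false) → (∀ i → σ multT i ≡ false) →
    (∀ i → σ found i ≡ false) →
    (some N (on found) (⟦ program ⟧ N σ) ≡ true → Found) ×
    ((∃[ a ] ∃[ b ] ∃[ c ] ∃[ d ] Obstruction N a b c d) → some N (on found) (⟦ program ⟧ N σ) ≡ true)
  program-correct σ matrix noSize noMult noFound = sound , complete
    where
    σ₁ σ₂ : State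
    σ₁ = ⟦ findSize ⟧ N σ
    σ₂ = ⟦ findMultiples ⟧ N σ₁
    prefix₁ : Prefix N (σ₁ sizeT) s
    prefix₁ = findSize-correct σ noSize
    ready : Ready σ₂
    ready = record
      { prefix = subst (λ f → Prefix N f s) (sym (spared findMultiples N σ₁ sizeT refl)) prefix₁
      ; mult   = findMultiples-correct σ₁ (λ i → trans (cong (λ f → f i) (spared findSize N σ multT refl)) (noMult i)) prefix₁
      ; matrix = λ u v → trans (cong (λ f → f (pos u v)) (trans (spared findMultiples N σ₁ inA refl) (spared findSize N σ inA refl))) (matrix u v) }
    found₂ : ∀ i → σ₂ found i ≡ false
    found₂ i = trans (cong (λ f → f i) (trans (spared findMultiples N σ₁ found refl) (spared findSize N σ found refl))) (noFound i)
    detects : Detects (∃[ a ] ∃[ b ] ∃[ c ] ∃[ d ] Obstruction N a b c d) search σ₂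
    detects = search-detects σ₂ ready
    sound : some N (on found) (⟦ program ⟧ N σ) ≡ true → Found
    sound e = let i , _ , ei = anyBelow-witness N _ e in
      proj₁ detects (λ i e → true≢false e (found₂ i)) i ei
    complete : _ → some N (on found) (⟦ program ⟧ N σ) ≡ true
    complete ob = anyBelow-true _ {0} (≤-trans (s≤s z≤n) s≤N) (proj₂ (proj₂ detects) ob)

  program-decides : ∀ σ → (∀ u v → σ inA (pos u v) ≡ E u v) → (∀ i → σ sizeT i ≡ false) → (∀ i → σ multT i ≡ false) →
    (∀ i → σ found i ≡ false) → (accepts N σ ≡ true) ⇔ TwoChordalBipartite G
  program-decides σ matrix noSize noMult noFound = mk⇔ to from
    where
    correct = program-correct σ matrix noSize noMult noFound
    to : accepts N σ ≡ true → TwoChordalBipartite G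
    to e = no-obstruction⇒two N large λ a b c d ob →
      true≢false refl (trans (sym e) (cong not (proj₂ correct (a , b , c , d , ob))))
      where
      large : s + s ≤ N
      large = ≤-trans (+-monoˡ-≤ s (m≤m*n s s)) (≤-reflexive (sym N≡))
    from : TwoChordalBipartite G → accepts N σ ≡ true
    from two = cong not (≢true⇒false λ e →
      let m , a , b , c , d , ob = proj₁ correct e in contradiction two (obstruction⇒¬two m a b c d ob))

-- The input word, the machine and its running time.

nth : List Bool → ℕ → Bool
nth []       i       = false
nth (b ∷ bs) zero    = b
nth (b ∷ bs) (suc i) = nth bs i

nth-++-< : ∀ xs {ys i} → i < length xs → nth (xs ++ ys) i ≡ nth xs i
nth-++-< (x ∷ xs) {i = zero}  _         = refl
nth-++-< (x ∷ xs) {i = suc i} (s≤s i<n) = nth-++-< xs i<n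

nth-++-+ : ∀ xs {ys} i → nth (xs ++ ys) (length xs + i) ≡ nth ys i
nth-++-+ []       i = refl
nth-++-+ (x ∷ xs) i = nth-++-+ xs i

nth-tabulate : ∀ {n} (f : Fin n → Bool) i → nth (List.tabulate f) (toℕ i) ≡ f i
nth-tabulate f fzero    = refl
nth-tabulate f (fsuc i) = nth-tabulate (f ∘ fsuc) i

module _ {A : Set} (g : A → List Bool) {s : ℕ} (len : ∀ x → length (g x) ≡ s) where

  length-blocks : ∀ {k} (h : Fin k → A) → length (concatMap g (List.tabulate h)) ≡ k * s
  length-blocks {zero}  h = refl
  length-blocks {suc k} h = trans (length-++ (g (h fzero))) (cong₂ _+_ (len _) (length-blocks (h ∘ fsuc)))

  nth-blocks : ∀ {k} (h : Fin k → A) {ys} u {j} → j < s →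
               nth (concatMap g (List.tabulate h) ++ ys) (toℕ u * s + j) ≡ nth (g (h u)) j
  nth-blocks h {ys} fzero j<s =
    trans (cong (λ zs → nth zs _) (++-assoc (g (h fzero)) _ ys))
          (nth-++-< (g (h fzero)) (subst (_ <_) (sym (len _)) j<s))
  nth-blocks h {ys} (fsuc u) {j} j<s =
    trans (cong₂ nth (++-assoc (g (h fzero)) _ ys)
            (trans (+-assoc s (toℕ u * s) j) (cong (_+ (toℕ u * s + j)) (sym (len (h fzero))))))
      (trans (nth-++-+ (g (h fzero)) (toℕ u * s + j)) (nth-blocks (h ∘ fsuc) u j<s))

bits : ∀ {s} → BipartiteGraph s → List Bool
bits {s} G = concatMap (λ u → map (adj G u) (allFin s)) (allFin s) ++ map (side G) (allFin s)

encode-bits : ∀ {g s} (G : BipartiteGraph s) → encode {g} G ≡ map bit (bits G)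
encode-bits {s = s} G = sym (trans (map-++ bit (concatMap (λ u → map (adj G u) (allFin s)) (allFin s)) _)
  (cong₂ _++_
    (trans (map-concatMap bit _ (allFin s)) (concatMap-cong (λ u → sym (map-∘ (allFin s))) (allFin s)))
    (sym (map-∘ (allFin s)))))

length-row : ∀ {s} (f : Fin s → Bool) → length (map f (allFin s)) ≡ s
length-row {s} f = trans (length-map f (allFin s)) (length-tabulate (λ i → i))

length-bits : ∀ {s} (G : BipartiteGraph s) → length (bits G) ≡ s * s + s
length-bits {s} G = trans (length-++ (concatMap (λ u → map (adj G u) (allFin s)) (allFin s)))
  (cong₂ _+_ (length-blocks (λ u → map (adj G u) (allFin s)) (λ u → length-row (adj G u)) (λ i → i)) (length-row (side G)))

nth-bits : ∀ {s} (G : BipartiteGraph s) u v → nth (bits G) (toℕ u * s + toℕ v) ≡ adj G u v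
nth-bits {s} G u v =
  trans (nth-blocks (λ u → map (adj G u) (allFin s)) (λ u → length-row (adj G u)) (λ i → i) u (toℕ<n v))
    (trans (cong (λ zs → nth zs (toℕ v)) (map-tabulate (λ i → i) (adj G u))) (nth-tabulate (adj G u) v))

inputState : List Bool → State
inputState bs fzero    i = nth bs i
inputState bs (fsuc _) i = false

inputCell : Bool → Cell
inputCell b = tabulate (λ { fzero → b ; (fsuc _) → false })

enc-input : ∀ bs k σ → (∀ i → tabulate (at σ (k + i)) ≡ inputCell (nth bs i)) → enc k (length bs) σ ≡ map inputCell bs
enc-input []       k σ h = refl
enc-input (b ∷ bs) k σ h = cong₂ _∷_ (trans (cong (λ i → tabulate (at σ i)) (sym (+-identityʳ k))) (h 0))
  (enc-input bs (suc k) σ (λ i → trans (cong (λ n → tabulate (at σ n)) (sym (+-suc k i))) (h (suc i))))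

open Machine Cell

decider : Code
decider = seq (compile program) (sweep (noneM (on found)) true)

abstract
  Cell-finite : Finite Cell
  Cell-finite = Vec-finite Bool-finite 20

open Realize Cell-finite inputCell decider

deciderCost : ℕ → ℕ
deciderCost N = cost program N + sweepCost N

decider-halts : ∀ bs → HaltsWithin machine (map bit bs) (deciderCost (length bs)) (accepts (length bs) (inputState bs))
decider-halts bs = Exec-halts bs (subst (λ w → Exec decider (deciderCost (length bs)) w (accepts (length bs) (inputState bs)) (enc 0 (length bs) σ′))
  (enc-input bs 0 (inputState bs) (λ i → refl))
  (Exec-seq (proj₂ (compile-correct program program-wellFormed (length bs) (inputState bs)))
            (Exec-none (on found) (length bs) σ′)))
  where
  σ′ : State
  σ′ = ⟦ program ⟧ (length bs) (inputState bs)

accepts-correct : ∀ s (G : BipartiteGraph s) → (accepts (length (bits G)) (inputState (bits G)) ≡ true) ⇔ TwoChordalBipartite G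
-- Without vertices the tape is empty, so nothing is found, and there is no cycle.
accepts-correct zero    G = mk⇔ (λ _ n c _ _ → contradiction (toℕ<n (c fzero)) λ ()) (λ _ → refl)
accepts-correct (suc s′) G = Correctness.program-decides s′ G (length (bits G)) (length-bits G)
  (inputState (bits G)) (nth-bits G) (λ _ → refl) (λ _ → refl) (λ _ → refl)

abstract
  deciderCost-polynomial : Polynomial deciderCost
  deciderCost-polynomial = polynomial-+ (cost-polynomial program) (polynomial-affine 3 2)

coefficient degree : ℕ
coefficient = proj₁ deciderCost-polynomial
degree      = proj₁ (proj₂ deciderCost-polynomial)

-- The cost is polynomial in the input length, which is quadratic in s; this doubles the degree.
bits-cost : ∀ {s} (G : BipartiteGraph s) → deciderCost (length (bits G)) ≤ coefficient * suc s ^ (2 * degree)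
bits-cost {s} G = begin
  deciderCost (length (bits G))                ≤⟨ proj₂ (proj₂ deciderCost-polynomial) (length (bits G)) ⟩
  coefficient * suc (length (bits G)) ^ degree ≡⟨ cong (λ n → coefficient * suc n ^ degree) (length-bits G) ⟩
  coefficient * suc (s * s + s) ^ degree       ≤⟨ *-monoʳ-≤ coefficient (^-monoˡ-≤ degree square) ⟩
  coefficient * (suc s ^ 2) ^ degree           ≡⟨ cong (coefficient *_) (^-*-assoc (suc s) 2 degree) ⟩
  coefficient * suc s ^ (2 * degree)           ∎
  where
  open ≤-Reasoning
  square : suc (s * s + s) ≤ suc s ^ 2
  square = ≤-trans (m≤m+n (suc (s * s + s)) s) (≤-reflexive (trans (expand s) (cong (suc s *_) (sym (*-identityʳ (suc s))))))
    where
    expand : ∀ s → suc (s * s + s) + s ≡ suc s * suc s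
    expand = solve-∀

theorem5p1 : Σ TM λ M → Σ ℕ λ c → Σ ℕ λ d →
    ∀ (s : ℕ) (G : BipartiteGraph s) → Σ Bool λ b →
    HaltsWithin M (encode G) (c * suc s ^ d) b
    × ((b ≡ true) ⇔ TwoChordalBipartite G)
theorem5p1 = machine , coefficient , 2 * degree , λ s G → accepts (length (bits G)) (inputState (bits G)) ,
  subst (λ w → HaltsWithin machine w (coefficient * suc s ^ (2 * degree)) (accepts (length (bits G)) (inputState (bits G)))) (sym (encode-bits G))
    (run-mono (bits-cost G) (decider-halts (bits G))) ,
  accepts-correct s G
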